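{- (1) If $\gcd(3,q-1)=1$, then there is no $\mathbb{F}_q$-plane $\mathcal B\in\mathrm{Orb}(\mathsf S_T)$ with only Type III points and only Type III lines such that $\mu_{\mathrm{pt}}$ maps the points of $\mathcal B$ onto the lines of $\mathcal B$ and $\mu_{\mathrm{line}}$ maps the lines of $\mathcal B$ onto the points of $\mathcal B$. (2) If $\gcd(3,q-1)=3$, then the $\mathbb{F}_q$-planes of $\mathrm{Orb}(\mathsf S_T)$ fixed setwise by $\mu$ in this sense are exactly the two planes $\pi_\lambda=\{(x,x^q,\lambda x^{q^2}):x\in\mathbb{F}_{q^3}^*\}$ with $\lambda\in\mathbb{F}_q$, $\lambda^3=1$, $\lambda\neq1$.
   Context: Let $q$ be a prime power, $\mathbb{F}_{q^3}^*=\mathbb{F}_{q^3}\setminus\{0\}$. Points of $\mathrm{PG}(2,q^3)$ have coordinates $(x,y,z)$, lines $[a,b,c]$. An $\mathbb{F}_q$-plane is a subplane of order $q$; its lines are those meeting it in $q+1$ points. Let $\phi$ be the collineation $(x,y,z)\mapsto(z^q,x^q,y^q)$ (on lines $[d,e,f]\mapsto[f^q,d^q,e^q]$). A point has Type I, II, III according as its $\phi$-orbit is one point, three collinear points, three non-collinear points; a line has Type I, II, III according as its $\phi$-orbit is one line, three concurrent lines, three non-concurrent lines. The map $\mu$ is the involutory bijection between Type III points and Type III lines given by $\mu_{\mathrm{pt}}(P)=P^\phi P^{\phi^2}$ and $\mu_{\mathrm{line}}(\ell)=\ell^\phi\cap\ell^{\phi^2}$. Let $\psi_t\colon(x,y,z)\mapsto(tx,t^qy,t^{q^2}z)$,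 $\mathsf S_T=\{\psi_t:t\in\mathbb{F}_{q^3}^*\}$, $\mathrm{Orb}(\mathsf S_T)$ its set of point orbits. An $\mathbb{F}_q$-plane $\mathcal B$ with only Type III points and lines is fixed setwise by $\mu$ if $\{\mu_{\mathrm{pt}}(P):P\in\mathcal B\}$ is the set of lines of $\mathcal B$ and $\{\mu_{\mathrm{line}}(\ell):\ell$ a line of $\mathcal B\}$ is the set of points of $\mathcal B$. -}

module Defs where

open import Level using (0ℓ)
open import Data.Nat as ℕ using (ℕ; zero; suc)
open import Data.Nat.Primality using (Prime)
open import Data.Product using (Σ; ∃; ∃-syntax; _×_; _,_)
open import Data.List using (List; length)
open import Data.List.Membership.Propositional using (_∈_)
open import Data.List.Relation.Unary.Unique.Propositional using (Unique)
open import Relation.Binary.PropositionalEquality using (_≡_; _≢_)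
open import Relation.Binary.Definitions using (DecidableEquality)
open import Relation.Nullary using (¬_)
open import Algebra.Structures using (IsCommutativeRing)

IsPrimePower : ℕ → Set
IsPrimePower q = ∃[ p ] ∃[ k ] (Prime p × q ≡ p ℕ.^ suc k)

HasCard : {A : Set} → ℕ → (A → Set) → Set
HasCard {A} n P = Σ (List A) λ xs → length xs ≡ n × Unique xs × (∀ a → (a ∈ xs → P a) × (P a → a ∈ xs))

record FiniteField : Set₁ where
  field
    Carrier : Set
    _+_ _*_ : Carrier → Carrier → Carrier
    -_ : Carrier → Carrier
    0# 1# : Carrier
    isCommutativeRing : IsCommutativeRing _≡_ _+_ _*_ -_ 0# 1#
    0≢1 : 0# ≢ 1#
    inverse : ∀ x → x ≢ 0# → ∃[ y ] (x * y ≡ 1#)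
    _≟_ : DecidableEquality Carrier
    elements : List Carrier
    elements-unique : Unique elements
    elements-complete : ∀ x → x ∈ elements

  card : ℕ
  card = length elements

-- The projective plane PG(2,K) over a finite field K (K plays the role of F_{q^3}),
-- with Frobenius exponent q.
module PG (F : FiniteField) (q : ℕ) where
  open FiniteField F

  K : Set
  K = Carrier

  _^_ : K → ℕ → K
  x ^ zero = 1#
  x ^ suc n = x * (x ^ n)

  K* : K → Set
  K* x = x ≢ 0#

  InFq : K → Set
  InFq x = x ^ q ≡ x

  V3 : Set
  V3 = K × K × K

  _·_ : K → V3 → V3
  c · (x , y , z) = (c * x , c * y , c * z)

  data Point : Set where
    pt1 : K → K → Point
    pt2 : K → Point
    pt3 : Point

  rep : Point → V3
  rep (pt1 y z) = (1# , y , z)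
  rep (pt2 z) = (0# , 1# , z)
  rep pt3 = (0# , 0# , 1#)

  data Line : Set where
    ln1 : K → K → Line
    ln2 : K → Line
    ln3 : Line

  lrep : Line → V3
  lrep (ln1 b c) = (1# , b , c)
  lrep (ln2 c) = (0# , 1# , c)
  lrep ln3 = (0# , 0# , 1#)

  Inc : V3 → V3 → Set
  Inc (x , y , z) (a , b , c) = ((a * x) + (b * y)) + (c * z) ≡ 0#

  Represents : Point → V3 → Set
  Represents P v = ∃[ c ] (K* c × v ≡ c · rep P)

  -- the collineation φ : (x,y,z) ↦ (z^q, x^q, y^q); on lines [d,e,f] ↦ [f^q,d^q,e^q]
  φ : V3 → V3
  φ (x , y , z) = (z ^ q , x ^ q , y ^ q)

  φ² : V3 → V3
  φ² v = φ (φ v)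

  Collinear : V3 → V3 → V3 → Set
  Collinear u v w = ∃[ ℓ ] (Inc u (lrep ℓ) × Inc v (lrep ℓ) × Inc w (lrep ℓ))

  Concurrent : V3 → V3 → V3 → Set
  Concurrent l m n = ∃[ P ] (Inc (rep P) l × Inc (rep P) m × Inc (rep P) n)

  TypeIIIPt : Point → Set
  TypeIIIPt P = ¬ Collinear (rep P) (φ (rep P)) (φ² (rep P))

  TypeIIILine : Line → Set
  TypeIIILine ℓ = ¬ Concurrent (lrep ℓ) (φ (lrep ℓ)) (φ² (lrep ℓ))

  PointSet : Set₁
  PointSet = Point → Set

  LineOf : PointSet → Line → Set
  LineOf B ℓ = HasCard (suc q) (λ P → B P × Inc (rep P) (lrep ℓ))

  FqPlane : PointSet → Set
  FqPlane B =
    (∀ P Q → B P → B Q → P ≢ Q → ∃[ ℓ ] (Inc (rep P) (lrep ℓ) × Inc (rep Q) (lrep ℓ)))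
    × (∀ P Q → B P → B Q → P ≢ Q → ∀ ℓ → Inc (rep P) (lrep ℓ) → Inc (rep Q) (lrep ℓ) → LineOf B ℓ)
    × (∀ ℓ m → LineOf B ℓ → LineOf B m → ℓ ≢ m → ∃[ P ] (B P × Inc (rep P) (lrep ℓ) × Inc (rep P) (lrep m)))
    × (∃[ P₁ ] ∃[ P₂ ] ∃[ P₃ ] ∃[ P₄ ] (B P₁ × B P₂ × B P₃ × B P₄
         × ¬ Collinear (rep P₁) (rep P₂) (rep P₃) × ¬ Collinear (rep P₁) (rep P₂) (rep P₄)
         × ¬ Collinear (rep P₁) (rep P₃) (rep P₄) × ¬ Collinear (rep P₂) (rep P₃) (rep P₄)))

  ψ : K → V3 → V3
  ψ t (x , y , z) = (t * x , (t ^ q) * y , (t ^ (q ℕ.* q)) * z)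

  InOrbST : PointSet → Set
  InOrbST B = ∃[ P₀ ] (∀ P → (B P → ∃[ t ] (K* t × Represents P (ψ t (rep P₀))))
                            × (∃[ t ] (K* t × Represents P (ψ t (rep P₀))) → B P))

  AllTypeIII : PointSet → Set
  AllTypeIII B = (∀ P → B P → TypeIIIPt P) × (∀ ℓ → LineOf B ℓ → TypeIIILine ℓ)

  -- μ_pt(P) = P^φ P^{φ²} and μ_line(ℓ) = ℓ^φ ∩ ℓ^{φ²}, given relationally:
  --   "ℓ = μ_pt(P)" iff P^φ and P^{φ²} lie on ℓ; "P = μ_line(ℓ)" iff P lies on ℓ^φ and ℓ^{φ²}
  -- (for Type III points/lines these determine a unique line/point).
  IsμPt : Point → Line → Set
  IsμPt P ℓ = Inc (φ (rep P)) (lrep ℓ) × Inc (φ² (rep P)) (lrep ℓ)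

  IsμLine : Line → Point → Set
  IsμLine ℓ P = Inc (rep P) (φ (lrep ℓ)) × Inc (rep P) (φ² (lrep ℓ))

  μFixed : PointSet → Set
  μFixed B =
    (∀ P ℓ → B P → IsμPt P ℓ → LineOf B ℓ)
    × (∀ ℓ → LineOf B ℓ → ∃[ P ] (B P × IsμPt P ℓ))
    × (∀ ℓ P → LineOf B ℓ → IsμLine ℓ P → B P)
    × (∀ P → B P → ∃[ ℓ ] (LineOf B ℓ × IsμLine ℓ P))

  Good : PointSet → Set
  Good B = FqPlane B × InOrbST B × AllTypeIII B × μFixed B

  πλ : K → PointSet
  πλ λ' P = ∃[ x ] (K* x × Represents P (x , x ^ q , λ' * (x ^ (q ℕ.* q))))

  Admissible : K → Set
  Admissible λ' = InFq λ' × λ' ^ 3 ≡ 1# × λ' ≢ 1#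

{-# OPTIONS --safe #-}
module Submission where

open import Defs
open import Algebra.Bundles using (CommutativeRing)
import Algebra.Properties.CommutativeSemiring.Binomial
import Algebra.Properties.CommutativeSemiring.Exp
import Algebra.Properties.Ring
import Algebra.Properties.Semiring.Mult
import Algebra.Properties.Semiring.Mult.TCOptimised
import Algebra.Properties.Semiring.Sum
import Algebra.Solver.Ring
open import Algebra.Solver.Ring.AlmostCommutativeRing using (fromCommutativeRing; _-Raw-AlmostCommutative⟶_)
open import Algebra.Structures using (IsCommutativeMonoid)
open import Data.Empty using (⊥; ⊥-elim)
open import Data.Fin using (Fin; zero; suc; inject₁; fromℕ)
open import Data.Fin.Properties using (toℕ-inject₁; toℕ-fromℕ; toℕ<n)
open import Data.Integer as ℤ using (ℤ; -[1+_]; +[1+_])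
import Data.Integer.Properties as ℤ
open import Data.List using (List; []; _∷_; _++_; length; map; filter; foldr; cartesianProduct)
open import Data.List.Membership.Propositional using (_∈_; lose; find)
open import Data.List.Membership.Propositional.Properties
open import Data.List.Membership.Propositional.Properties.WithK using (unique∧set⇒bag)
open import Data.List.Properties using (length-map; length-++; length-++-sucʳ)
open import Data.List.Relation.Binary.BagAndSetEquality using (∼bag⇒↭)
open import Data.List.Relation.Binary.Permutation.Propositional using (_↭_; ↭⇒↭ₛ)
open import Data.List.Relation.Binary.Permutation.Propositional.Properties using (↭-length)
open import Data.List.Relation.Binary.Permutation.Setoid.Properties using (foldr-commMonoid)
open import Data.List.Relation.Unary.All as All using (All; []; _∷_)
open import Data.List.Relation.Unary.All.Properties using (¬Any⇒All¬) renaming (map⁺ to All-map⁺)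
open import Data.List.Relation.Unary.AllPairs using (AllPairs; []; _∷_)
open import Data.List.Relation.Unary.Any as Any using (Any; here; there; any?)
open import Data.List.Relation.Unary.Any.Properties using () renaming (map⁺ to Any-map⁺)
open import Data.List.Relation.Unary.Unique.Propositional using (Unique)
import Data.List.Relation.Unary.Unique.Propositional.Properties as Unique
import Data.Maybe
open import Data.Nat as ℕ using (ℕ; zero; suc; s≤s; z≤n)
open import Data.Nat.Combinatorics using (_C_; nCk≡n!/k![n-k]!; k![n∸k]!∣n!; nCn≡1)
open import Data.Nat.Divisibility using (_∣_; divides; ∣-refl; ∣⇒≤; m∣m*n)
open import Data.Nat.DivMod using (m/n*n≡m; m≡m%n+[m/n]*n; m%n<n)
open import Data.Nat.GCD using (gcd; gcd[m,n]∣n; gcd-greatest)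
open import Data.Nat.Primality using (Prime; euclidsLemma; prime⇒nonTrivial; prime⇒nonZero; ¬prime[0])
import Data.Nat.Properties as ℕ
import Data.Nat.Solver
open import Data.Product using (Σ; ∃; ∃-syntax; _×_; _,_; proj₁; proj₂)
open import Data.Sum using (_⊎_; inj₁; inj₂; [_,_]′)
open import Data.Vec as Vec using (Vec; []; _∷_)
open import Function using (_∘_; mk⇔)
open import Level using (0ℓ)
open import Relation.Binary.Consequences using (dec⇒weaklyDec)
open import Relation.Binary.PropositionalEquality
open import Relation.Nullary using (¬_; Dec; yes; no; contradiction; ¬?)
open import Relation.Nullary.Decidable using (decidable-stable)

-- Write x′ = x^q. The orbit of (1, ρ, σ) consists of the points (t, ρt′, σt″), and the join of two of
-- them has normal (ρσU, σU′, ρU″) with U ≠ 0. If the plane is fixed, the line μ_pt(1, ρ, σ), whose normal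
-- (1 − ρ′σ″, ρ′ρ″ − σ′, σ′σ″ − ρ″) is read off a cross product, is such a join, so that
--   1 − w′ = kU,  N − w = kU′,  S − w″ = kU″   with  w = ρσ′,  N = ρρ′ρ″,  S = σσ′σ″,  ww′w″ = NS.
-- Comparing these equations with their conjugates gives w ∈ F_q and U′U′ = UU″. As kU + kU′ + kU″ is the
-- determinant that is nonzero for Type III points, U′ = U follows, whence N = S = 1 and w³ = 1 ≠ w.
-- Hilbert 90 then normalises ρ to 1 and σ to λ = w; such a λ exists only when 3 divides q − 1.
--
-- Conversely, for λ³ = 1 ≠ λ in F_q the lines of π_λ are those with normal (u, u′, λ²u″), because such a
-- line meets π_λ in the q + 1 classes modulo F_q* of nonzero x with Tr(ux) = 0. Points and lines of π_λ are
-- hence curves of one shape, with λ and λ² interchanged by duality, and μ exchanges the two families.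

-- The field is given only as a list of q³ elements, so its structure has to be counted out:
-- additivity of x ↦ x^q from the vanishing of q³·1, x‴ = x from the product of the nonzero
-- elements, an element `ζ` outside F_q from a root bound. The size of F_q must be known exactly,
-- since a line belongs to the plane only if it carries precisely q + 1 of its points. In the first
-- half the obstacle is that k and U are unknown elements of K. What helps is that 1, N and S are
-- fixed by conjugation: conjugating the three equations writes differences between 1, N, S and
-- conjugates of w as a conjugate of k times a conjugate of U, and two ways of pairing the same four
-- factors give a relation in w, N, S alone. No separate theory of lines is developed. Lines are
-- turned into points with the same coordinates, so one lemma on cross products covers joins and
-- meets, and one lemma used at λ and at λ² covers points and lines.

private variable
  X Y : Set
  xs ys : List X

-- Counting with duplicate-free lists, and primes dividing binomial coefficients

unique-⊆-length : Unique xs → (∀ {x} → x ∈ xs → x ∈ ys) → length xs ℕ.≤ length ys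
unique-⊆-length {xs = []} _ _ = z≤n
unique-⊆-length {xs = x ∷ xs} (x∉xs ∷ uxs) xs⊆ with as , bs , refl ← ∈-∃++ (xs⊆ (here refl)) = begin
  suc (length xs)         ≤⟨ s≤s (unique-⊆-length uxs rest) ⟩
  suc (length (as ++ bs)) ≡⟨ length-++-sucʳ as x bs ⟨
  length (as ++ x ∷ bs)   ∎
  where
  open ℕ.≤-Reasoning
  rest : ∀ {y} → y ∈ xs → y ∈ as ++ bs
  rest y∈xs with ∈-++⁻ as (xs⊆ (there y∈xs))
  ... | inj₁ y∈as           = ∈-++⁺ˡ y∈as
  ... | inj₂ (here refl)    = contradiction refl (All.lookup x∉xs y∈xs)
  ... | inj₂ (there y∈bs)   = ∈-++⁺ʳ as y∈bs

unique-set⇒↭ : Unique xs → Unique ys → (∀ {x} → x ∈ xs → x ∈ ys) → (∀ {x} → x ∈ ys → x ∈ xs) → xs ↭ ys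
unique-set⇒↭ uxs uys f g = ∼bag⇒↭ (unique∧set⇒bag uxs uys (mk⇔ f g))

foldr-↭ : ∀ {_∙_ : X → X → X} {ε} → IsCommutativeMonoid _≡_ _∙_ ε → xs ↭ ys → foldr _∙_ ε xs ≡ foldr _∙_ ε ys
foldr-↭ isCM p = foldr-commMonoid (setoid _) isCM (↭⇒↭ₛ p)

length-cartesianProduct : (xs : List X) (ys : List Y) → length (cartesianProduct xs ys) ≡ length xs ℕ.* length ys
length-cartesianProduct []       ys = refl
length-cartesianProduct (x ∷ xs) ys =
  trans (length-++ (map (x ,_) ys)) (cong₂ ℕ._+_ (length-map (x ,_) ys) (length-cartesianProduct xs ys))

prime∣!⇒≤ : ∀ {p} n → Prime p → p ∣ n ℕ.! → p ℕ.≤ n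
prime∣!⇒≤ zero p-prime p∣1 = contradiction (∣⇒≤ p∣1) (ℕ.<⇒≱ (ℕ.nonTrivial⇒n>1 _ {{prime⇒nonTrivial p-prime}}))
prime∣!⇒≤ (suc n) p-prime p∣ with euclidsLemma (suc n) (n ℕ.!) p-prime p∣
... | inj₁ p∣1+n = ∣⇒≤ p∣1+n
... | inj₂ p∣n!  = ℕ.m≤n⇒m≤1+n (prime∣!⇒≤ n p-prime p∣n!)

-- p divides p! = C · k! · (p-k)!, but neither k! nor (p-k)!, because all factors of these are below
-- p.
prime∣C : ∀ {p k} → Prime p → 0 ℕ.< k → k ℕ.< p → p ∣ p C k
prime∣C {p@(suc p-1)} {k} p-prime 0<k k<p with euclidsLemma (p C k) _ p-prime p∣C*k!*[p-k]!
  where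
  p∣C*k!*[p-k]! : p ∣ (p C k) ℕ.* (k ℕ.! ℕ.* (p ℕ.∸ k) ℕ.!)
  p∣C*k!*[p-k]! = subst (p ∣_)
    (sym (trans (cong (ℕ._* (k ℕ.! ℕ.* (p ℕ.∸ k) ℕ.!)) (nCk≡n!/k![n-k]! (ℕ.<⇒≤ k<p)))
                (m/n*n≡m {{k ℕ.!* (p ℕ.∸ k) !≢0}} (k![n∸k]!∣n! (ℕ.<⇒≤ k<p)))))
    (m∣m*n (p-1 ℕ.!))
... | inj₁ p∣C = p∣C
... | inj₂ p∣k!*[p-k]! with euclidsLemma (k ℕ.!) _ p-prime p∣k!*[p-k]!
...   | inj₁ p∣k!     = contradiction (prime∣!⇒≤ k p-prime p∣k!) (ℕ.<⇒≱ k<p)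
...   | inj₂ p∣[p-k]! = contradiction (prime∣!⇒≤ _ p-prime p∣[p-k]!) (ℕ.<⇒≱ (ℕ.∸-monoʳ-< 0<k (ℕ.<⇒≤ k<p)))

-- Field arithmetic and a solver for polynomial identities

module Field (F : FiniteField) (q : ℕ) where
  open FiniteField F public using (Carrier; 0≢1; inverse) renaming (_≟_ to infix 4 _≟_)
  open PG F q public

  commutativeRing : CommutativeRing 0ℓ 0ℓ
  commutativeRing = record { isCommutativeRing = FiniteField.isCommutativeRing F }

  open CommutativeRing commutativeRing public
    using (_+_; _*_; -_; _-_; 0#; 1#; +-identityˡ; +-identityʳ; *-identityˡ; *-identityʳ; zeroˡ; zeroʳ;
           +-assoc; +-comm; *-assoc; *-comm; distribˡ; distribʳ; -‿inverseˡ; -‿inverseʳ)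
  open CommutativeRing commutativeRing using (ring; semiring)
  open Algebra.Properties.Ring ring using (-0#≈0#; -‿involutive; -‿+-comm; -‿distribˡ-*; -‿distribʳ-*)
  open Algebra.Properties.Semiring.Mult.TCOptimised semiring
    using () renaming (_×_ to _⊠_; ×-homo-+ to ⊠-homo-+; ×1-homo-* to ⊠1-homo-*; 1+× to 1+⊠)

  -- The solver takes its coefficients from ℤ because integers compute, so that terms cancel in
  -- normal forms, whereas elements of the abstract field do not reduce. With this version of
  -- multiples the images of 0 and 1 are the field constants by computation.
  fromℤ : ℤ → K
  fromℤ (ℤ.+ n)    = n ⊠ 1#
  fromℤ -[1+ n ] = - (suc n ⊠ 1#)

  private
    -- Written out by hand, since the solver itself depends on it through `fromℤ-⊖`.
    cancel-1 : ∀ a b → a - b ≡ (1# + a) - (1# + b)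
    cancel-1 a b = begin
      a - b                      ≡⟨ +-identityˡ _ ⟨
      0# + (a - b)               ≡⟨ cong (_+ (a - b)) (-‿inverseʳ 1#) ⟨
      (1# - 1#) + (a - b)        ≡⟨ +-assoc _ _ _ ⟩
      1# + (- 1# + (a - b))      ≡⟨ cong (1# +_) (+-assoc _ _ _) ⟨
      1# + ((- 1# + a) - b)      ≡⟨ cong (λ z → 1# + (z - b)) (+-comm _ _) ⟩
      1# + ((a - 1#) - b)        ≡⟨ cong (1# +_) (+-assoc _ _ _) ⟩
      1# + (a + (- 1# - b))      ≡⟨ +-assoc _ _ _ ⟨
      (1# + a) + (- 1# - b)      ≡⟨ cong ((1# + a) +_) (-‿+-comm 1# b) ⟩
      (1# + a) - (1# + b)        ∎
      where open ≡-Reasoning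

    fromℤ-⊖ : ∀ m n → fromℤ (m ℤ.⊖ n) ≡ m ⊠ 1# - n ⊠ 1#
    fromℤ-⊖ zero    zero    = sym (-‿inverseʳ 0#)
    fromℤ-⊖ zero    (suc n) = sym (+-identityˡ _)
    fromℤ-⊖ (suc m) zero    = sym (trans (cong (suc m ⊠ 1# +_) -0#≈0#) (+-identityʳ _))
    fromℤ-⊖ (suc m) (suc n) = begin
      fromℤ (suc m ℤ.⊖ suc n)              ≡⟨ cong fromℤ (ℤ.[1+m]⊖[1+n]≡m⊖n m n) ⟩
      fromℤ (m ℤ.⊖ n)                      ≡⟨ fromℤ-⊖ m n ⟩
      m ⊠ 1# - n ⊠ 1#                      ≡⟨ cancel-1 _ _ ⟩
      (1# + m ⊠ 1#) - (1# + n ⊠ 1#)        ≡⟨ cong₂ _-_ (1+⊠ m 1#) (1+⊠ n 1#) ⟨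
      suc m ⊠ 1# - suc n ⊠ 1#              ∎
      where open ≡-Reasoning

    fromℤ-+ : ∀ i j → fromℤ (i ℤ.+ j) ≡ fromℤ i + fromℤ j
    fromℤ-+ (ℤ.+ m)  (ℤ.+ n)    = ⊠-homo-+ 1# m n
    fromℤ-+ (ℤ.+ m)  -[1+ n ]   = fromℤ-⊖ m (suc n)
    fromℤ-+ -[1+ m ] (ℤ.+ n)    = trans (fromℤ-⊖ n (suc m)) (+-comm _ _)
    fromℤ-+ -[1+ m ] -[1+ n ] = begin
      - (suc (suc (m ℕ.+ n)) ⊠ 1#)          ≡⟨ cong (λ k → - (suc k ⊠ 1#)) (ℕ.+-suc m n) ⟨
      - ((suc m ℕ.+ suc n) ⊠ 1#)            ≡⟨ cong -_ (⊠-homo-+ 1# (suc m) (suc n)) ⟩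
      - (suc m ⊠ 1# + suc n ⊠ 1#)           ≡⟨ -‿+-comm _ _ ⟨
      - (suc m ⊠ 1#) - (suc n ⊠ 1#)         ∎
      where open ≡-Reasoning

    fromℤ-neg : ∀ i → fromℤ (ℤ.- i) ≡ - fromℤ i
    fromℤ-neg (ℤ.+ zero)  = sym -0#≈0#
    fromℤ-neg +[1+ n ]  = refl
    fromℤ-neg -[1+ n ]  = sym (-‿involutive _)

    fromℤ-pos-* : ∀ m j → fromℤ (ℤ.+ m ℤ.* j) ≡ (m ⊠ 1#) * fromℤ j
    fromℤ-pos-* m (ℤ.+ n)    = trans (cong fromℤ (sym (ℤ.pos-* m n))) (⊠1-homo-* m n)
    fromℤ-pos-* m -[1+ n ] = begin
      fromℤ (ℤ.+ m ℤ.* -[1+ n ])          ≡⟨ cong fromℤ (ℤ.neg-distribʳ-* (ℤ.+ m) +[1+ n ]) ⟨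
      fromℤ (ℤ.- (ℤ.+ m ℤ.* +[1+ n ]))    ≡⟨ fromℤ-neg (ℤ.+ m ℤ.* +[1+ n ]) ⟩
      - fromℤ (ℤ.+ m ℤ.* +[1+ n ])        ≡⟨ cong -_ (fromℤ-pos-* m +[1+ n ]) ⟩
      - ((m ⊠ 1#) * (suc n ⊠ 1#))       ≡⟨ -‿distribʳ-* _ _ ⟩
      (m ⊠ 1#) * - (suc n ⊠ 1#)         ∎
      where open ≡-Reasoning

    fromℤ-* : ∀ i j → fromℤ (i ℤ.* j) ≡ fromℤ i * fromℤ j
    fromℤ-* (ℤ.+ m)    j = fromℤ-pos-* m j
    fromℤ-* -[1+ m ] j = begin
      fromℤ (-[1+ m ] ℤ.* j)          ≡⟨ cong fromℤ (ℤ.neg-distribˡ-* +[1+ m ] j) ⟨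
      fromℤ (ℤ.- (+[1+ m ] ℤ.* j))    ≡⟨ fromℤ-neg (+[1+ m ] ℤ.* j) ⟩
      - fromℤ (+[1+ m ] ℤ.* j)        ≡⟨ cong -_ (fromℤ-pos-* (suc m) j) ⟩
      - ((suc m ⊠ 1#) * fromℤ j)      ≡⟨ -‿distribˡ-* _ _ ⟩
      - (suc m ⊠ 1#) * fromℤ j        ∎
      where open ≡-Reasoning

    homomorphism : ℤ.+-*-rawRing -Raw-AlmostCommutative⟶ fromCommutativeRing commutativeRing
    homomorphism = record
      { ⟦_⟧ = fromℤ ; +-homo = fromℤ-+ ; *-homo = fromℤ-* ; -‿homo = fromℤ-neg
      ; 0-homo = refl ; 1-homo = refl }

  open Algebra.Solver.Ring ℤ.+-*-rawRing (fromCommutativeRing commutativeRing) homomorphism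
    (λ i j → Data.Maybe.map (cong fromℤ) (dec⇒weaklyDec ℤ._≟_ i j)) public
    using (Polynomial; _:+_; _:*_; :-_; _:-_; _:=_; con; solve)

  𝟘 𝟙 : ∀ {n} → Polynomial n
  𝟘 = con (ℤ.+ 0)
  𝟙 = con (ℤ.+ 1)

  open FiniteField F using (elements; elements-unique; elements-complete; card)
  private
    module R = CommutativeRing commutativeRing

  x-y≡0⇒x≡y : ∀ {x y} → x - y ≡ 0# → x ≡ y
  x-y≡0⇒x≡y {x} {y} = Algebra.Properties.Ring.x∙y⁻¹≈ε⇒x≈y R.ring x y

  x≡y⇒x-y≡0 : ∀ {x y} → x ≡ y → x - y ≡ 0#
  x≡y⇒x-y≡0 refl = -‿inverseʳ _

  infixl 9 _⁻¹
  -- Total, with default value 0 at 0, so that terms such as `curvePoint` carry no proof of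
  -- nonvanishing; the lemmas about it ask for that proof instead.
  _⁻¹ : K → K
  x ⁻¹ with x ≟ 0#
  ... | yes _   = 0#
  ... | no  x≢0 = proj₁ (inverse x x≢0)

  *-inverseʳ : ∀ {x} → x ≢ 0# → x * x ⁻¹ ≡ 1#
  *-inverseʳ {x} x≢0 with x ≟ 0#
  ... | yes x≡0 = contradiction x≡0 x≢0
  ... | no  x≢0 = proj₂ (inverse x x≢0)

  *-inverseˡ : ∀ {x} → x ≢ 0# → x ⁻¹ * x ≡ 1#
  *-inverseˡ x≢0 = trans (*-comm _ _) (*-inverseʳ x≢0)

  x⁻¹*[x*y]≡y : ∀ {x} y → x ≢ 0# → x ⁻¹ * (x * y) ≡ y
  x⁻¹*[x*y]≡y y x≢0 = trans (sym (*-assoc _ _ _)) (trans (cong (_* y) (*-inverseˡ x≢0)) (*-identityˡ y))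

  x*[x⁻¹*y]≡y : ∀ {x} y → x ≢ 0# → x * (x ⁻¹ * y) ≡ y
  x*[x⁻¹*y]≡y y x≢0 = trans (sym (*-assoc _ _ _)) (trans (cong (_* y) (*-inverseʳ x≢0)) (*-identityˡ y))

  *-cancelˡ : ∀ {a x y} → a ≢ 0# → a * x ≡ a * y → x ≡ y
  *-cancelˡ {a} {x} {y} a≢0 eq =
    trans (sym (x⁻¹*[x*y]≡y x a≢0)) (trans (cong (a ⁻¹ *_) eq) (x⁻¹*[x*y]≡y y a≢0))

  xy≡0⇒y≡0 : ∀ {x y} → x ≢ 0# → x * y ≡ 0# → y ≡ 0#
  xy≡0⇒y≡0 x≢0 xy≡0 = *-cancelˡ x≢0 (trans xy≡0 (sym (zeroʳ _)))

  xy≢0 : ∀ {x y} → x ≢ 0# → y ≢ 0# → x * y ≢ 0#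
  xy≢0 x≢0 y≢0 xy≡0 = y≢0 (xy≡0⇒y≡0 x≢0 xy≡0)

  xy≡0⇒x≡0⊎y≡0 : ∀ {x y} → x * y ≡ 0# → x ≡ 0# ⊎ y ≡ 0#
  xy≡0⇒x≡0⊎y≡0 {x} xy≡0 with x ≟ 0#
  ... | yes x≡0 = inj₁ x≡0
  ... | no  x≢0 = inj₂ (xy≡0⇒y≡0 x≢0 xy≡0)

  x⁻¹≢0 : ∀ {x} → x ≢ 0# → x ⁻¹ ≢ 0#
  x⁻¹≢0 {x} x≢0 x⁻¹≡0 = 0≢1 (trans (sym (zeroʳ x)) (trans (cong (x *_) (sym x⁻¹≡0)) (*-inverseʳ x≢0)))

  private
    module Exp = Algebra.Properties.CommutativeSemiring.Exp R.commutativeSemiring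

    ^≡Exp^ : ∀ x n → x ^ n ≡ x Exp.^ n
    ^≡Exp^ x zero    = refl
    ^≡Exp^ x (suc n) = cong (x *_) (^≡Exp^ x n)

  ^-homo-* : ∀ x m n → x ^ (m ℕ.+ n) ≡ x ^ m * x ^ n
  ^-homo-* x m n rewrite ^≡Exp^ x (m ℕ.+ n) | ^≡Exp^ x m | ^≡Exp^ x n = Exp.^-homo-* x m n

  ^-assoc : ∀ x m n → (x ^ m) ^ n ≡ x ^ (m ℕ.* n)
  ^-assoc x m n rewrite ^≡Exp^ (x ^ m) n | ^≡Exp^ x m | ^≡Exp^ x (m ℕ.* n) = Exp.^-assocʳ x m n

  ^-distrib-* : ∀ x y n → (x * y) ^ n ≡ x ^ n * y ^ n
  ^-distrib-* x y n rewrite ^≡Exp^ (x * y) n | ^≡Exp^ x n | ^≡Exp^ y n = Exp.^-distrib-* x y n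

  1^n≡1 : ∀ n → 1# ^ n ≡ 1#
  1^n≡1 zero    = refl
  1^n≡1 (suc n) = trans (*-identityˡ _) (1^n≡1 n)

  x^n≡0⇒x≡0 : ∀ {x} n → x ^ n ≡ 0# → x ≡ 0#
  x^n≡0⇒x≡0 zero    1≡0   = contradiction (sym 1≡0) 0≢1
  x^n≡0⇒x≡0 (suc n) x^n≡0 with xy≡0⇒x≡0⊎y≡0 x^n≡0
  ... | inj₁ x≡0   = x≡0
  ... | inj₂ x^n≡0 = x^n≡0⇒x≡0 n x^n≡0

  -- Roots of monic polynomials

  -- The leading coefficient 1 is implicit: cs stands for c₀ + c₁ X + ⋯ + cₙ₋₁ Xⁿ⁻¹ + Xⁿ.
  monicEval : ∀ {n} → Vec K n → K → K
  monicEval []       x = 1#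
  monicEval (c ∷ cs) x = c + x * monicEval cs x

  -- p + k·g for g of degree one less than p, which leaves the implicit leading coefficient 1
  -- untouched.
  addScaled : ∀ {n} → Vec K (suc n) → K → Vec K n → Vec K (suc n)
  addScaled (c ∷ cs) k []       = (c + k) ∷ cs
  addScaled (c ∷ cs) k (d ∷ ds) = (c + k * d) ∷ addScaled cs k ds

  -- Synthetic division, giving (p(X) - p(r)) / (X - r). For p = c + X·p₁ the quotient is p₁ + r·g₁,
  -- where g₁ is the quotient belonging to p₁.
  quotient : ∀ {n} → K → Vec K (suc n) → Vec K n
  quotient r (c ∷ [])         = []
  quotient r (c ∷ cs@(_ ∷ _)) = addScaled cs r (quotient r cs)

  eval-addScaled : ∀ {n} (p : Vec K (suc n)) k (g : Vec K n) x →
    monicEval (addScaled p k g) x ≡ monicEval p x + k * monicEval g x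
  eval-addScaled (c ∷ []) k [] x =
    solve 3 (λ c k x → c :+ k :+ x :* 𝟙 := c :+ x :* 𝟙 :+ k :* 𝟙) refl c k x
  eval-addScaled (c ∷ p) k (d ∷ g) x = trans
    (cong (λ z → c + k * d + x * z) (eval-addScaled p k g x))
    (solve 6 (λ c k d x p g → c :+ k :* d :+ x :* (p :+ k :* g) := c :+ x :* p :+ k :* (d :+ x :* g))
      refl c k d x (monicEval p x) (monicEval g x))

  eval-quotient : ∀ {n} r (p : Vec K (suc n)) x →
    monicEval p x - monicEval p r ≡ (x - r) * monicEval (quotient r p) x
  eval-quotient r (c ∷ []) x =
    solve 3 (λ c r x → c :+ x :* 𝟙 :- (c :+ r :* 𝟙) := (x :- r) :* 𝟙) refl c r x
  eval-quotient r (c ∷ p@(_ ∷ _)) x = begin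
    c + x * monicEval p x - (c + r * monicEval p r)
      ≡⟨ solve 5 (λ c r x px pr → c :+ x :* px :- (c :+ r :* pr) := (x :- r) :* px :+ r :* (px :- pr))
           refl c r x (monicEval p x) (monicEval p r) ⟩
    (x - r) * monicEval p x + r * (monicEval p x - monicEval p r)
      ≡⟨ cong (λ z → (x - r) * monicEval p x + r * z) (eval-quotient r p x) ⟩
    (x - r) * monicEval p x + r * ((x - r) * monicEval (quotient r p) x)
      ≡⟨ solve 4 (λ r x px g → (x :- r) :* px :+ r :* ((x :- r) :* g) := (x :- r) :* (px :+ r :* g))
           refl r x (monicEval p x) (monicEval (quotient r p) x) ⟩
    (x - r) * (monicEval p x + r * monicEval (quotient r p) x)
      ≡⟨ cong ((x - r) *_) (eval-addScaled p r (quotient r p) x) ⟨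
    (x - r) * monicEval (addScaled p r (quotient r p)) x
      ∎
    where open ≡-Reasoning

  -- Divide by X - r for the first root r. The remaining roots differ from r, so in the absence of
  -- zero divisors they are roots of the quotient.
  length-roots≤degree : ∀ {n} (p : Vec K n) {xs} → Unique xs → All (λ x → monicEval p x ≡ 0#) xs → length xs ℕ.≤ n
  length-roots≤degree p  []            _          = z≤n
  length-roots≤degree [] (_ ∷ _)       (1≡0 ∷ _)  = contradiction (sym 1≡0) 0≢1
  length-roots≤degree p@(_ ∷ _) {r ∷ _} (r∉xs ∷ uxs) (pr≡0 ∷ pxs≡0) =
    s≤s (length-roots≤degree (quotient r p) uxs (All.zipWith root (r∉xs , pxs≡0)))
    where
    root : ∀ {x} → r ≢ x × monicEval p x ≡ 0# → monicEval (quotient r p) x ≡ 0#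
    root {x} (r≢x , px≡0) = xy≡0⇒y≡0 (λ x-r≡0 → r≢x (sym (x-y≡0⇒x≡y x-r≡0)))
      (trans (sym (eval-quotient r p x)) (x≡y⇒x-y≡0 (trans px≡0 (sym pr≡0))))

  length-powerFixed≤ : ∀ {n xs} → 2 ℕ.≤ n → Unique xs → All (λ x → x ^ n ≡ x) xs → length xs ℕ.≤ n
  length-powerFixed≤ {suc (suc n)} (s≤s (s≤s z≤n)) uxs fixed =
    -- The coefficients 0, -1, 0, ..., 0 encode X^(n+2) - X; exponent at least 2 keeps the term -X
    -- apart from the implicit leading term.
    length-roots≤degree (0# ∷ - 1# ∷ Vec.replicate n 0#) uxs (All.map root fixed)
    where
    eval-X^ : ∀ n x → monicEval (Vec.replicate n 0#) x ≡ x ^ n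
    eval-X^ zero    x = refl
    eval-X^ (suc n) x = trans (+-identityˡ _) (cong (x *_) (eval-X^ n x))
    root : ∀ {x} → x * (x * x ^ n) ≡ x → 0# + x * (- 1# + x * monicEval (Vec.replicate n 0#) x) ≡ 0#
    root {x} fixed rewrite eval-X^ n x = trans
      (solve 2 (λ x y → 𝟘 :+ x :* (:- 𝟙 :+ x :* y) := x :* (x :* y) :- x) refl x (x ^ n))
      (x≡y⇒x-y≡0 fixed)

  -- Sums and products over the whole field

  private
    module Mult = Algebra.Properties.Semiring.Mult R.semiring

    sum-shift : ∀ xs → foldr _+_ 0# (map (1# +_) xs) ≡ length xs Mult.× 1# + foldr _+_ 0# xs
    sum-shift []       = sym (+-identityˡ 0#)
    sum-shift (x ∷ xs) = trans (cong ((1# + x) +_) (sum-shift xs))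
      (solve 4 (λ o x n s → (o :+ x) :+ (n :+ s) := (o :+ n) :+ (x :+ s)) refl 1# x (length xs Mult.× 1#) (foldr _+_ 0# xs))

    product-scale : ∀ a xs → foldr _*_ 1# (map (a *_) xs) ≡ a ^ length xs * foldr _*_ 1# xs
    product-scale a []       = sym (*-identityˡ 1#)
    product-scale a (x ∷ xs) = trans (cong ((a * x) *_) (product-scale a xs))
      (solve 4 (λ a x n s → (a :* x) :* (n :* s) := (a :* n) :* (x :* s)) refl a x (a ^ length xs) (foldr _*_ 1# xs))

    units : List K
    units = filter (λ x → ¬? (x ≟ 0#)) elements

    units-unique : Unique units
    units-unique = Unique.filter⁺ (λ x → ¬? (x ≟ 0#)) elements-unique

    ≢0⇒∈units : ∀ {x} → x ≢ 0# → x ∈ units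
    ≢0⇒∈units x≢0 = ∈-filter⁺ (λ x → ¬? (x ≟ 0#)) (elements-complete _) x≢0

    ∈units⇒≢0 : ∀ {x} → x ∈ units → x ≢ 0#
    ∈units⇒≢0 x∈ = proj₂ (∈-filter⁻ (λ x → ¬? (x ≟ 0#)) {xs = elements} x∈)

    elements↭0∷units : elements ↭ 0# ∷ units
    elements↭0∷units = unique-set⇒↭ elements-unique
      (All.tabulate (λ x∈ 0≡x → ∈units⇒≢0 x∈ (sym 0≡x)) ∷ units-unique) to (λ _ → elements-complete _)
      where
      to : ∀ {x} → x ∈ elements → x ∈ 0# ∷ units
      to {x} _ with x ≟ 0#
      ... | yes refl = here refl
      ... | no  x≢0  = there (≢0⇒∈units x≢0)

    product-units≢0 : foldr _*_ 1# units ≢ 0#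
    product-units≢0 = go units ∈units⇒≢0
      where
      go : ∀ xs → (∀ {x} → x ∈ xs → x ≢ 0#) → foldr _*_ 1# xs ≢ 0#
      go []       _  = 0≢1 ∘ sym
      go (x ∷ xs) nz = xy≢0 (nz (here refl)) (go xs (nz ∘ there))

  -- Translation by 1 permutes the field, so the sum s of all elements satisfies s = card·1 + s.
  card×1≡0 : card Mult.× 1# ≡ 0#
  card×1≡0 = begin
    n                ≡⟨ solve 2 (λ n s → n := n :+ s :- s) refl n s ⟩
    n + s - s        ≡⟨ cong (_- s) (sum-shift elements) ⟨
    foldr _+_ 0# (map (1# +_) elements) - s
      ≡⟨ cong (_- s) (foldr-↭ R.+-isCommutativeMonoid (unique-set⇒↭
           (Unique.map⁺ shift-injective elements-unique) elements-unique (λ _ → elements-complete _) shift-onto)) ⟩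
    s - s            ≡⟨ -‿inverseʳ s ⟩
    0#               ∎
    where
    open ≡-Reasoning
    n = card Mult.× 1#
    s = foldr _+_ 0# elements
    shift-injective : ∀ {x y} → 1# + x ≡ 1# + y → x ≡ y
    shift-injective {x} {y} eq = x-y≡0⇒x≡y (trans
      (solve 2 (λ x y → x :- y := 𝟙 :+ x :- (𝟙 :+ y)) refl x y) (x≡y⇒x-y≡0 eq))
    shift-onto : ∀ {x} → x ∈ elements → x ∈ map (1# +_) elements
    shift-onto {x} _ = subst (_∈ map (1# +_) elements)
      (solve 1 (λ x → 𝟙 :+ (x :- 𝟙) := x) refl x) (∈-map⁺ (1# +_) (elements-complete (x - 1#)))

  -- Multiplication by x ≠ 0 permutes the nonzero elements and so preserves their product, which is
  -- itself nonzero. The rewrite exhibits the exponent as one more than the number of nonzero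
  -- elements.
  x^card≡x : ∀ x → x ^ card ≡ x
  x^card≡x x rewrite ↭-length elements↭0∷units with x ≟ 0#
  ... | yes refl = zeroˡ _
  ... | no  x≢0  = trans (cong (x *_) (*-cancelˡ product-units≢0 (begin
    foldr _*_ 1# units * x ^ length units    ≡⟨ *-comm _ _ ⟩
    x ^ length units * foldr _*_ 1# units    ≡⟨ product-scale x units ⟨
    foldr _*_ 1# (map (x *_) units)
      ≡⟨ foldr-↭ R.*-isCommutativeMonoid (unique-set⇒↭
           (Unique.map⁺ (*-cancelˡ x≢0) units-unique) units-unique scale-into scale-onto) ⟩
    foldr _*_ 1# units                       ≡⟨ *-identityʳ _ ⟨
    foldr _*_ 1# units * 1#                  ∎))) (*-identityʳ x)
    where
    open ≡-Reasoning
    scale-into : ∀ {y} → y ∈ map (x *_) units → y ∈ units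
    scale-into y∈ with z , z∈ , refl ← ∈-map⁻ (x *_) y∈ = ≢0⇒∈units (xy≢0 x≢0 (∈units⇒≢0 z∈))
    scale-onto : ∀ {y} → y ∈ units → y ∈ map (x *_) units
    scale-onto {y} y∈ = subst (_∈ map (x *_) units) (x*[x⁻¹*y]≡y y x≢0)
      (∈-map⁺ (x *_) (≢0⇒∈units (xy≢0 (x⁻¹≢0 x≢0) (∈units⇒≢0 y∈))))

  -- Characteristic p and additivity of the Frobenius map

  module _ {p} (p-prime : Prime p) (p×1≡0 : p Mult.× 1# ≡ 0#) where
    private
      multiple×x≡0 : ∀ {m} x → p ∣ m → m Mult.× x ≡ 0#
      multiple×x≡0 x (divides k refl) = begin
        (k ℕ.* p) Mult.× x       ≡⟨ Mult.×-assocˡ x k p ⟨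
        k Mult.× (p Mult.× x)    ≡⟨ cong (k Mult.×_) p×x≡0 ⟩
        k Mult.× 0#              ≡⟨ k×0≡0 k ⟩
        0#                       ∎
        where
        open ≡-Reasoning
        p×x≡0 : p Mult.× x ≡ 0#
        p×x≡0 = begin
          p Mult.× x           ≡⟨ cong (p Mult.×_) (*-identityˡ x) ⟨
          p Mult.× (1# * x)    ≡⟨ Mult.×-assoc-* p 1# x ⟨
          (p Mult.× 1#) * x    ≡⟨ cong (_* x) p×1≡0 ⟩
          0# * x               ≡⟨ zeroˡ x ⟩
          0#                   ∎
        k×0≡0 : ∀ k → k Mult.× 0# ≡ 0#
        k×0≡0 zero    = refl
        k×0≡0 (suc k) = trans (+-identityˡ _) (k×0≡0 k)

    [x+y]^p≡x^p+y^p : ∀ x y → (x + y) ^ p ≡ x ^ p + y ^ p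
    [x+y]^p≡x^p+y^p x y = begin
      (x + y) ^ p              ≡⟨ ^≡Exp^ (x + y) p ⟩
      (x + y) Exp.^ p          ≡⟨ Binomial.theorem p x y ⟩
      Sum.sum (Binomial.binomialTerm x y p)   ≡⟨ ends p refl ⟩
      x Exp.^ p + y Exp.^ p    ≡⟨ cong₂ _+_ (^≡Exp^ x p) (^≡Exp^ y p) ⟨
      x ^ p + y ^ p            ∎
      where
      open ≡-Reasoning
      module Binomial = Algebra.Properties.CommutativeSemiring.Binomial R.commutativeSemiring
      module Sum = Algebra.Properties.Semiring.Sum R.semiring

      -- The exponent is generalised to an n equal to p, so that matching on it can expose a
      -- successor; this allows both end terms to be split off the binomial sum, and `prime∣C` kills
      -- the rest.
      ends : ∀ n → n ≡ p → Sum.sum (Binomial.binomialTerm x y n) ≡ x Exp.^ n + y Exp.^ n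
      ends zero    refl = contradiction p-prime ¬prime[0]
      ends (suc r) refl = begin
        t zero + Sum.sum (t ∘ suc)
          ≡⟨ cong (t zero +_) (Sum.sum-init-last (t ∘ suc)) ⟩
        t zero + (Sum.sum (λ i → t (suc (inject₁ i))) + t (suc (fromℕ r)))
          ≡⟨ cong₂ (λ a b → a + (Sum.sum (λ i → t (suc (inject₁ i))) + b)) first last ⟩
        y Exp.^ suc r + (Sum.sum (λ i → t (suc (inject₁ i))) + x Exp.^ suc r)
          ≡⟨ cong (λ a → y Exp.^ suc r + (a + x Exp.^ suc r))
               (trans (Sum.sum-cong-≗ middle) (Sum.sum-replicate-zero r)) ⟩
        y Exp.^ suc r + (0# + x Exp.^ suc r)
          ≡⟨ solve 2 (λ a b → b :+ (𝟘 :+ a) := a :+ b) refl (x Exp.^ suc r) (y Exp.^ suc r) ⟩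
        x Exp.^ suc r + y Exp.^ suc r ∎
        where
        t : Fin (suc (suc r)) → K
        t = Binomial.binomialTerm x y (suc r)
        first : t zero ≡ y Exp.^ suc r
        first = trans (+-identityʳ _) (*-identityˡ _)
        middle : ∀ i → t (suc (inject₁ i)) ≡ 0#
        middle i = multiple×x≡0 _ (prime∣C p-prime (s≤s z≤n)
          (s≤s (subst (ℕ._< r) (sym (toℕ-inject₁ i)) (toℕ<n i))))
        last : t (suc (fromℕ r)) ≡ x Exp.^ suc r
        last rewrite toℕ-fromℕ r | nCn≡1 (suc r) | ℕ.n∸n≡0 r = trans (+-identityʳ _) (*-identityʳ _)

    [x+y]^p^n≡x^p^n+y^p^n : ∀ n x y → (x + y) ^ (p ℕ.^ n) ≡ x ^ (p ℕ.^ n) + y ^ (p ℕ.^ n)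
    [x+y]^p^n≡x^p^n+y^p^n zero    x y = trans (*-identityʳ _) (sym (cong₂ _+_ (*-identityʳ x) (*-identityʳ y)))
    [x+y]^p^n≡x^p^n+y^p^n (suc n) x y = begin
      (x + y) ^ (p ℕ.* p ℕ.^ n)                ≡⟨ ^-assoc (x + y) p (p ℕ.^ n) ⟨
      ((x + y) ^ p) ^ (p ℕ.^ n)                ≡⟨ cong (_^ (p ℕ.^ n)) ([x+y]^p≡x^p+y^p x y) ⟩
      (x ^ p + y ^ p) ^ (p ℕ.^ n)              ≡⟨ [x+y]^p^n≡x^p^n+y^p^n n (x ^ p) (y ^ p) ⟩
      (x ^ p) ^ (p ℕ.^ n) + (y ^ p) ^ (p ℕ.^ n) ≡⟨ cong₂ _+_ (^-assoc x p _) (^-assoc y p _) ⟩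
      x ^ (p ℕ.* p ℕ.^ n) + y ^ (p ℕ.* p ℕ.^ n) ∎
      where open ≡-Reasoning

  -- The number of elements is a power of p and annihilates 1, so some power of p·1 is 0; a field
  -- has no nilpotents, hence p·1 = 0.
  ^-distrib-+ : IsPrimePower q → card ≡ q ℕ.^ 3 → ∀ x y → (x + y) ^ q ≡ x ^ q + y ^ q
  ^-distrib-+ (p , k , p-prime , refl) card≡ = [x+y]^p^n≡x^p^n+y^p^n p-prime p×1≡0 (suc k)
    where
    n^m×1≡[n×1]^m : ∀ n m → (n ℕ.^ m) Mult.× 1# ≡ (n Mult.× 1#) ^ m
    n^m×1≡[n×1]^m n zero    = +-identityʳ 1#
    n^m×1≡[n×1]^m n (suc m) = trans (Mult.×1-homo-* n (n ℕ.^ m)) (cong ((n Mult.× 1#) *_) (n^m×1≡[n×1]^m n m))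
    p×1≡0 : p Mult.× 1# ≡ 0#
    p×1≡0 = x^n≡0⇒x≡0 (suc k ℕ.* 3) (begin
      (p Mult.× 1#) ^ (suc k ℕ.* 3)         ≡⟨ n^m×1≡[n×1]^m p (suc k ℕ.* 3) ⟨
      (p ℕ.^ (suc k ℕ.* 3)) Mult.× 1#       ≡⟨ cong (Mult._× 1#) (ℕ.^-*-assoc p (suc k) 3) ⟨
      ((p ℕ.^ suc k) ℕ.^ 3) Mult.× 1#       ≡⟨ cong (Mult._× 1#) card≡ ⟨
      card Mult.× 1#                        ≡⟨ card×1≡0 ⟩
      0#                                    ∎)
      where open ≡-Reasoning

  2≤q : IsPrimePower q → 2 ℕ.≤ q
  2≤q (p , k , p-prime , refl) = ℕ.≤-trans (ℕ.nonTrivial⇒n>1 p {{prime⇒nonTrivial p-prime}})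
    (ℕ.m≤m*n p (p ℕ.^ k) {{ℕ.m^n≢0 p k {{prime⇒nonZero p-prime}}}})

  -- Otherwise X^n - X would have more roots than its degree. With n = q this yields `ζ`, with n = m
  -- + 1 an element whose m-th power is a cube root of unity other than 1.
  ∃x^n≢x : ∀ {n} → 2 ℕ.≤ n → n ℕ.< card → ∃[ x ] (x ^ n ≢ x)
  ∃x^n≢x {n} 2≤n n<card with any? (λ x → ¬? (x ^ n ≟ x)) elements
  ... | yes some = Any.satisfied some
  ... | no  none = contradiction
    (length-powerFixed≤ 2≤n elements-unique
      (All.map (λ {x} → decidable-stable (x ^ n ≟ x)) (¬Any⇒All¬ elements none)))
    (ℕ.<⇒≱ n<card)

-- Conjugation x ↦ x^q on a field of q³ elements

module CubicField (F : FiniteField) (q : ℕ) (primePower : IsPrimePower q)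
                      (card≡q³ : FiniteField.card F ≡ q ℕ.^ 3) where
  open Field F q public
  open FiniteField F using (elements; elements-unique; elements-complete; card)

  infixl 9 _′
  _′ : K → K
  x ′ = x ^ q

  +-′ : ∀ x y → (x + y) ′ ≡ x ′ + y ′
  +-′ = ^-distrib-+ primePower card≡q³

  *-′ : ∀ x y → (x * y) ′ ≡ x ′ * y ′
  *-′ x y = ^-distrib-* x y q

  1′ : 1# ′ ≡ 1#
  1′ = 1^n≡1 q

  0′ : 0# ′ ≡ 0#
  0′ = begin
    0# ′                  ≡⟨ solve 1 (λ z → z := z :+ z :- z) refl (0# ′) ⟩
    0# ′ + 0# ′ - 0# ′    ≡⟨ cong (_- 0# ′) (+-′ 0# 0#) ⟨
    (0# + 0#) ′ - 0# ′    ≡⟨ cong (λ z → z ′ - 0# ′) (+-identityˡ 0#) ⟩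
    0# ′ - 0# ′           ≡⟨ -‿inverseʳ _ ⟩
    0#                    ∎
    where open ≡-Reasoning

  neg-′ : ∀ x → (- x) ′ ≡ - (x ′)
  neg-′ x = begin
    (- x) ′                  ≡⟨ solve 2 (λ x y → y := x :+ y :- x) refl (x ′) ((- x) ′) ⟩
    x ′ + (- x) ′ - x ′      ≡⟨ cong (_- x ′) (+-′ x (- x)) ⟨
    (x - x) ′ - x ′          ≡⟨ cong (λ z → z ′ - x ′) (-‿inverseʳ x) ⟩
    0# ′ - x ′               ≡⟨ cong (_- x ′) 0′ ⟩
    0# - x ′                 ≡⟨ +-identityˡ _ ⟩
    - (x ′)                  ∎
    where open ≡-Reasoning

  minus-′ : ∀ x y → (x - y) ′ ≡ x ′ - y ′
  minus-′ x y = trans (+-′ x (- y)) (cong (x ′ +_) (neg-′ y))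

  x^[q*q]≡x′′ : ∀ x → x ^ (q ℕ.* q) ≡ x ′ ′
  x^[q*q]≡x′′ x = sym (^-assoc x q q)

  x′′′≡x : ∀ x → x ′ ′ ′ ≡ x
  x′′′≡x x = begin
    x ′ ′ ′                    ≡⟨ cong _′ (x^[q*q]≡x′′ x) ⟨
    (x ^ (q ℕ.* q)) ′          ≡⟨ ^-assoc x (q ℕ.* q) q ⟩
    x ^ (q ℕ.* q ℕ.* q)        ≡⟨ cong (x ^_) (trans (q*q*q≡q^3 q) (sym card≡q³)) ⟩
    x ^ card                   ≡⟨ x^card≡x x ⟩
    x                          ∎
    where
    open ≡-Reasoning
    open Data.Nat.Solver.+-*-Solver renaming (solve to ℕ-solve; _:=_ to _⊜_; _:*_ to _⊛_; _:^_ to _⊛^_) using ()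
    q*q*q≡q^3 : ∀ q → q ℕ.* q ℕ.* q ≡ q ℕ.^ 3
    q*q*q≡q^3 = ℕ-solve 1 (λ q → q ⊛ q ⊛ q ⊜ q ⊛^ 3) refl

  x′≢0 : ∀ {x} → x ≢ 0# → x ′ ≢ 0#
  x′≢0 x≢0 x′≡0 = x≢0 (x^n≡0⇒x≡0 q x′≡0)

  ′-injective : ∀ {x y} → x ′ ≡ y ′ → x ≡ y
  ′-injective {x} {y} x′≡y′ = trans (sym (x′′′≡x x)) (trans (cong (λ z → z ′ ′) x′≡y′) (x′′′≡x y))

  -- This and its two companions turn an ideal membership into a vanishing proof: the solver checks
  -- an identity with explicit cofactors, the other arguments say that the generators are 0.
  linear₁ : ∀ {t a e} → t ≡ a * e → e ≡ 0# → t ≡ 0#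
  linear₁ t≡ refl = trans t≡ (zeroʳ _)

  linear₂ : ∀ {t a b e f} → t ≡ a * e + b * f → e ≡ 0# → f ≡ 0# → t ≡ 0#
  linear₂ t≡ refl refl = trans t≡ (trans (cong₂ _+_ (zeroʳ _) (zeroʳ _)) (+-identityʳ _))

  linear₃ : ∀ {t a b c e f g} → t ≡ a * e + b * f + c * g → e ≡ 0# → f ≡ 0# → g ≡ 0# → t ≡ 0#
  linear₃ t≡ refl refl refl = trans t≡ (trans (cong₂ _+_ (linear₂ refl refl refl) (zeroʳ _)) (+-identityʳ _))

  -- The coefficients of (T - y)(T - z) combine the three equations into (x - y)(x - z)a = 0. The
  -- other two unknowns follow by cyclic rotation.
  vandermonde : ∀ {x y z a b c} → x ≢ y → y ≢ z → z ≢ x →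
    a + b + c ≡ 0# → x * a + y * b + z * c ≡ 0# → x * x * a + y * y * b + z * z * c ≡ 0# →
    a ≡ 0# × b ≡ 0# × c ≡ 0#
  vandermonde {x} {y} {z} {a} {b} {c} x≢y y≢z z≢x e₀ e₁ e₂ =
    xy≡0⇒y≡0 (xy≢0 (x≢y ∘ x-y≡0⇒x≡y) (z≢x ∘ sym ∘ x-y≡0⇒x≡y)) (linear₃ (identity x y z a b c) e₂ e₁ e₀) ,
    xy≡0⇒y≡0 (xy≢0 (y≢z ∘ x-y≡0⇒x≡y) (x≢y ∘ sym ∘ x-y≡0⇒x≡y))
      (linear₃ (identity y z x b c a) (trans (rotate _ _ _) e₂) (trans (rotate _ _ _) e₁) (trans (rotate _ _ _) e₀)) ,
    xy≡0⇒y≡0 (xy≢0 (z≢x ∘ x-y≡0⇒x≡y) (y≢z ∘ sym ∘ x-y≡0⇒x≡y))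
      (linear₃ (identity z x y c a b) (trans (sym (rotate _ _ _)) e₂) (trans (sym (rotate _ _ _)) e₁)
        (trans (sym (rotate _ _ _)) e₀))
    where
    rotate : ∀ a b c → b + c + a ≡ a + b + c
    rotate = solve 3 (λ a b c → b :+ c :+ a := a :+ b :+ c) refl
    identity : ∀ x y z a b c → (x - y) * (x - z) * a ≡
      1# * (x * x * a + y * y * b + z * z * c) + - (y + z) * (x * a + y * b + z * c) + (y * z) * (a + b + c)
    identity = solve 6 (λ x y z a b c → (x :- y) :* (x :- z) :* a :=
      𝟙 :* (x :* x :* a :+ y :* y :* b :+ z :* z :* c) :+ (:- (y :+ z)) :* (x :* a :+ y :* b :+ z :* c) :+ (y :* z) :* (a :+ b :+ c)) refl

  Tr : K → K
  Tr x = x + x ′ + x ′ ′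

  Tr-inFq : ∀ x → InFq (Tr x)
  Tr-inFq x rewrite +-′ (x + x ′) (x ′ ′) | +-′ x (x ′) | x′′′≡x x =
    solve 3 (λ a b c → b :+ c :+ a := a :+ b :+ c) refl x (x ′) (x ′ ′)

  Tr-minus : ∀ x y → Tr (x - y) ≡ Tr x - Tr y
  Tr-minus x y rewrite minus-′ x y | minus-′ (x ′) (y ′) =
    solve 6 (λ x x₁ x₂ y y₁ y₂ → x :- y :+ (x₁ :- y₁) :+ (x₂ :- y₂) := x :+ x₁ :+ x₂ :- (y :+ y₁ :+ y₂))
      refl x (x ′) (x ′ ′) y (y ′) (y ′ ′)

  q<card : q ℕ.< card
  q<card = subst (q ℕ.<_) (sym card≡q³) (subst (ℕ._< q ℕ.^ 3) (ℕ.*-identityʳ q) (ℕ.^-monoʳ-< q (2≤q primePower) {1} {3} (s≤s (s≤s z≤n))))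

  private
    primitive-element : ∃[ x ] (x ′ ≢ x)
    primitive-element = ∃x^n≢x (2≤q primePower) q<card

  -- Any element outside F_q. Because x‴ = x, its three conjugates are distinct, so evaluating at 1,
  -- ζ, ζ² always produces a regular Vandermonde system; this replaces the choice of a basis of K
  -- over F_q.
  ζ : K
  ζ = proj₁ primitive-element

  ζ≢ζ′ : ζ ≢ ζ ′
  ζ≢ζ′ = proj₂ primitive-element ∘ sym

  ζ′≢ζ′′ : ζ ′ ≢ ζ ′ ′
  ζ′≢ζ′′ = ζ≢ζ′ ∘ ′-injective

  ζ′′≢ζ : ζ ′ ′ ≢ ζ
  ζ′′≢ζ eq = ζ≢ζ′ (trans (sym (x′′′≡x ζ)) (cong _′ eq))

  Fq : List K
  Fq = filter (λ x → x ′ ≟ x) elements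

  Fq-unique : Unique Fq
  Fq-unique = Unique.filter⁺ (λ x → x ′ ≟ x) elements-unique

  inFq⇒∈Fq : ∀ {x} → InFq x → x ∈ Fq
  inFq⇒∈Fq = ∈-filter⁺ (λ x → x ′ ≟ x) (elements-complete _)

  ∈Fq⇒inFq : ∀ {x} → x ∈ Fq → InFq x
  ∈Fq⇒inFq x∈ = proj₂ (∈-filter⁻ (λ x → x ′ ≟ x) {xs = elements} x∈)

  -- x is determined by its traces against 1, ζ, ζ², which bounds |F_q| from below by q.
  private
    traces : K → K × K × K
    traces x = Tr x , Tr (ζ * x) , Tr (ζ * (ζ * x))

    traces-injective : ∀ {x y} → traces x ≡ traces y → x ≡ y
    traces-injective {x} {y} eq = x-y≡0⇒x≡y (proj₁ (vandermonde ζ≢ζ′ ζ′≢ζ′′ ζ′′≢ζ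
      (Tr[x-y]≡0 (cong proj₁ eq))
      (trans (sym (Tr-ζ* (x - y))) (trans (cong Tr (*-minus ζ x y)) (Tr[x-y]≡0 (cong (proj₁ ∘ proj₂) eq))))
      (trans (sym (Tr-ζ*ζ* (x - y))) (trans (cong Tr (trans (cong (ζ *_) (*-minus ζ x y)) (*-minus ζ _ _)))
        (Tr[x-y]≡0 (cong (proj₂ ∘ proj₂) eq))))))
      where
      Tr[x-y]≡0 : ∀ {x y} → Tr x ≡ Tr y → Tr (x - y) ≡ 0#
      Tr[x-y]≡0 {x} {y} eq = trans (Tr-minus x y) (x≡y⇒x-y≡0 eq)
      *-minus : ∀ z x y → z * (x - y) ≡ z * x - z * y
      *-minus = solve 3 (λ z x y → z :* (x :- y) := z :* x :- z :* y) refl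
      Tr-ζ* : ∀ z → Tr (ζ * z) ≡ ζ * z + ζ ′ * z ′ + ζ ′ ′ * z ′ ′
      Tr-ζ* z rewrite *-′ ζ z | *-′ (ζ ′) (z ′) = refl
      Tr-ζ*ζ* : ∀ z → Tr (ζ * (ζ * z)) ≡ ζ * ζ * z + ζ ′ * ζ ′ * z ′ + ζ ′ ′ * ζ ′ ′ * z ′ ′
      Tr-ζ*ζ* z rewrite *-′ ζ (ζ * z) | *-′ ζ z | *-′ (ζ ′) (ζ ′ * z ′) | *-′ (ζ ′) (z ′) =
        sym (cong₂ _+_ (cong₂ _+_ (*-assoc _ _ _) (*-assoc _ _ _)) (*-assoc _ _ _))

    traces∈Fq³ : ∀ {t} → t ∈ map traces elements → t ∈ cartesianProduct Fq (cartesianProduct Fq Fq)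
    traces∈Fq³ t∈ with x , _ , refl ← ∈-map⁻ traces t∈ = ∈-cartesianProduct⁺ (inFq⇒∈Fq (Tr-inFq _))
      (∈-cartesianProduct⁺ (inFq⇒∈Fq (Tr-inFq _)) (inFq⇒∈Fq (Tr-inFq _)))

  -- The root bound for X^q - X gives one inequality; for the other, `traces` embeds q³ elements
  -- into the cube of `Fq`. The value becomes the q in the count q + 1 of points on a line.
  length-Fq : length Fq ≡ q
  length-Fq = ℕ.≤-antisym
    (length-powerFixed≤ (2≤q primePower) Fq-unique (All.tabulate ∈Fq⇒inFq))
    (ℕ.≮⇒≥ λ Fq<q → ℕ.<⇒≱ (ℕ.^-monoˡ-< 3 Fq<q) q³≤Fq³)
    where
    open ℕ.≤-Reasoning
    q³≤Fq³ : q ℕ.^ 3 ℕ.≤ length Fq ℕ.^ 3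
    q³≤Fq³ = begin
      q ℕ.^ 3                       ≡⟨ card≡q³ ⟨
      card                          ≡⟨ length-map traces elements ⟨
      length (map traces elements)  ≤⟨ unique-⊆-length (Unique.map⁺ traces-injective elements-unique) traces∈Fq³ ⟩
      length (cartesianProduct Fq (cartesianProduct Fq Fq))
        ≡⟨ length-cartesianProduct Fq (cartesianProduct Fq Fq) ⟩
      length Fq ℕ.* length (cartesianProduct Fq Fq)
        ≡⟨ cong (length Fq ℕ.*_) (length-cartesianProduct Fq Fq) ⟩
      length Fq ℕ.* (length Fq ℕ.* length Fq)
        ≡⟨ cong (λ n → length Fq ℕ.* (length Fq ℕ.* n)) (ℕ.*-identityʳ (length Fq)) ⟨
      length Fq ℕ.^ 3               ∎

  -- Traces, norms and cube roots of unity

  -- c is a Lagrange resolvent θ + ρθ′ + ρρ′θ″: multiplying its conjugate by ρ permutes the three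
  -- terms, since ρ has norm 1. It cannot vanish at θ = 1, ζ and ζ² at once, because by
  -- `vandermonde` the coefficient 1 of θ would then be 0.
  hilbert90 : ∀ {ρ} → ρ * ρ ′ * ρ ′ ′ ≡ 1# → ∃[ c ] (c ≢ 0# × ρ * c ′ ≡ c)
  hilbert90 {ρ} norm≡1 = pick (resolvent 1# ≟ 0#) (resolvent ζ ≟ 0#) (resolvent (ζ * ζ) ≟ 0#)
    where
    resolvent : K → K
    resolvent θ = θ + ρ * θ ′ + ρ * ρ ′ * θ ′ ′
    resolvent-fixed : ∀ θ → ρ * resolvent θ ′ ≡ resolvent θ
    resolvent-fixed θ
      rewrite +-′ (θ + ρ * θ ′) (ρ * ρ ′ * θ ′ ′) | +-′ θ (ρ * θ ′) | *-′ ρ (θ ′)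
            | *-′ (ρ * ρ ′) (θ ′ ′) | *-′ ρ (ρ ′) | x′′′≡x θ = trans
      (solve 6 (λ ρ ρ₁ ρ₂ θ θ₁ θ₂ → ρ :* (θ₁ :+ ρ₁ :* θ₂ :+ ρ₁ :* ρ₂ :* θ) := ρ :* ρ₁ :* ρ₂ :* θ :+ ρ :* θ₁ :+ ρ :* ρ₁ :* θ₂)
        refl ρ (ρ ′) (ρ ′ ′) θ (θ ′) (θ ′ ′))
      (cong (λ z → z + ρ * θ ′ + ρ * ρ ′ * θ ′ ′) (trans (cong (_* θ) norm≡1) (*-identityˡ θ)))
    pick : Dec (resolvent 1# ≡ 0#) → Dec (resolvent ζ ≡ 0#) → Dec (resolvent (ζ * ζ) ≡ 0#) →
           ∃[ c ] (c ≢ 0# × ρ * c ′ ≡ c)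
    pick (no ≢0) _ _ = _ , ≢0 , resolvent-fixed 1#
    pick _ (no ≢0) _ = _ , ≢0 , resolvent-fixed ζ
    pick _ _ (no ≢0) = _ , ≢0 , resolvent-fixed (ζ * ζ)
    pick (yes e₀) (yes e₁) (yes e₂) = contradiction
      (proj₁ (vandermonde ζ≢ζ′ ζ′≢ζ′′ ζ′′≢ζ
        (trans (cong₂ _+_ (cong (1# +_) (sym (trans (cong (ρ *_) 1′) (*-identityʳ _))))
                          (sym (trans (cong (ρ * ρ ′ *_) 1′′) (*-identityʳ _)))) e₀)
        (trans (solve 5 (λ z z₁ z₂ r r₁ → z :* 𝟙 :+ z₁ :* r :+ z₂ :* (r :* r₁) := z :+ r :* z₁ :+ r :* r₁ :* z₂)
          refl ζ (ζ ′) (ζ ′ ′) ρ (ρ ′)) e₁)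
        (trans (trans (solve 5 (λ z z₁ z₂ r r₁ → z :* z :* 𝟙 :+ z₁ :* z₁ :* r :+ z₂ :* z₂ :* (r :* r₁)
                                := z :* z :+ r :* (z₁ :* z₁) :+ r :* r₁ :* (z₂ :* z₂))
                 refl ζ (ζ ′) (ζ ′ ′) ρ (ρ ′))
               (sym (cong₂ (λ a b → ζ * ζ + ρ * a + ρ * ρ ′ * b) (*-′ ζ ζ) (trans (cong _′ (*-′ ζ ζ)) (*-′ (ζ ′) (ζ ′)))))) e₂)))
      (0≢1 ∘ sym)
      where
      1′′ : 1# ′ ′ ≡ 1#
      1′′ = trans (cong _′ 1′) 1′

  -- On the kernel of Tr this form takes values in F_q and vanishes exactly on F_q-proportional pairs.
  D : K → K → K
  D x y = x * y ′ - x ′ * y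

  -- The conjugate of `D x y` exceeds `D x y` by x′ Tr y - y′ Tr x.
  D-inFq : ∀ {x y} → Tr x ≡ 0# → Tr y ≡ 0# → InFq (D x y)
  D-inFq {x} {y} Trx≡0 Try≡0
    rewrite minus-′ (x * y ′) (x ′ * y) | *-′ x (y ′) | *-′ (x ′) y = x-y≡0⇒x≡y (linear₂
      (solve 6 (λ x x₁ x₂ y y₁ y₂ → x₁ :* y₂ :- x₂ :* y₁ :- (x :* y₁ :- x₁ :* y)
         := :- y₁ :* (x :+ x₁ :+ x₂) :+ x₁ :* (y :+ y₁ :+ y₂)) refl x (x ′) (x ′ ′) y (y ′) (y ′ ′))
      Trx≡0 Try≡0)

  D-scale : ∀ c x y → D (c * x) (c * y) ≡ c * c ′ * D x y
  D-scale c x y rewrite *-′ c x | *-′ c y = solve 6 (λ c c₁ x x₁ y y₁ →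
    c :* x :* (c₁ :* y₁) :- c₁ :* x₁ :* (c :* y) := c :* c₁ :* (x :* y₁ :- x₁ :* y))
    refl c (c ′) x (x ′) y (y ′)

  -- Coboundaries of ζ and ζ², so their traces telescope to 0. `D e₁ e₂` is a product of differences
  -- of conjugates of ζ, hence nonzero: the two form a basis of the kernel of `Tr` over F_q.
  e₁ e₂ : K
  e₁ = ζ ′ - ζ
  e₂ = ζ ′ * ζ ′ - ζ * ζ

  Tr-coboundary : ∀ x → Tr (x ′ - x) ≡ 0#
  Tr-coboundary x rewrite minus-′ (x ′) x | minus-′ (x ′ ′) (x ′) | x′′′≡x x =
    solve 3 (λ a b c → b :- a :+ (c :- b) :+ (a :- c) := 𝟘) refl x (x ′) (x ′ ′)

  Tr-e₁ : Tr e₁ ≡ 0#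
  Tr-e₁ = Tr-coboundary ζ

  Tr-e₂ : Tr e₂ ≡ 0#
  Tr-e₂ = trans (cong (λ z → Tr (z - ζ * ζ)) (sym (*-′ ζ ζ))) (Tr-coboundary (ζ * ζ))

  D-e₁-e₂≢0 : D e₁ e₂ ≢ 0#
  D-e₁-e₂≢0 D≡0 = xy≢0 (xy≢0 (λ e → ζ≢ζ′ (sym (x-y≡0⇒x≡y e))) (λ e → ζ′≢ζ′′ (sym (x-y≡0⇒x≡y e))))
    (ζ′′≢ζ ∘ x-y≡0⇒x≡y) (trans (sym factor) D≡0)
    where
    factor : D e₁ e₂ ≡ (ζ ′ - ζ) * (ζ ′ ′ - ζ ′) * (ζ ′ ′ - ζ)
    factor rewrite minus-′ (ζ ′) ζ | minus-′ (ζ ′ * ζ ′) (ζ * ζ) | *-′ (ζ ′) (ζ ′) | *-′ ζ ζ =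
      solve 3 (λ a b c → (b :- a) :* (c :* c :- b :* b) :- (c :- b) :* (b :* b :- a :* a)
        := (b :- a) :* (c :- b) :* (c :- a)) refl ζ (ζ ′) (ζ ′ ′)

  cubeRoot⇒1+x+x²≡0 : ∀ {x} → x ^ 3 ≡ 1# → x ≢ 1# → 1# + x + x * x ≡ 0#
  cubeRoot⇒1+x+x²≡0 {x} x³≡1 x≢1 = xy≡0⇒y≡0 (x≢1 ∘ x-y≡0⇒x≡y) (trans
    (solve 1 (λ x → (x :- 𝟙) :* (𝟙 :+ x :+ x :* x) := x :* (x :* (x :* 𝟙)) :- 𝟙) refl x)
    (x≡y⇒x-y≡0 x³≡1))

  cubeRoot≢0 : ∀ {x} → x ^ 3 ≡ 1# → x ≢ 0#
  cubeRoot≢0 x³≡1 refl = 0≢1 (trans (sym (zeroˡ _)) x³≡1)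

  -- Since the lines of π_λ belong to λ², this lets results on its points be applied to its lines.
  admissible-square : ∀ {x} → Admissible x → Admissible (x * x)
  admissible-square {x} (x′≡x , x³≡1 , x≢1) =
    trans (*-′ x x) (cong₂ _*_ x′≡x x′≡x) ,
    trans (^-distrib-* x x 3) (trans (cong₂ _*_ x³≡1 x³≡1) (*-identityˡ 1#)) ,
    λ x²≡1 → x≢1 (trans (sym (trans (cong (x *_) (trans (cong (x *_) (*-identityʳ x)) x²≡1)) (*-identityʳ x))) x³≡1)

  -- A nonzero x in F_q has x^(q-1) = 1. As 3 does not divide q - 1, reducing the exponent modulo 3
  -- leaves x = 1 or x² = 1, and the latter with x³ = 1 also gives x = 1.
  cubeRootUnique : gcd 3 (q ℕ.∸ 1) ≡ 1 → ∀ {x} → InFq x → x ^ 3 ≡ 1# → x ≡ 1#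
  cubeRootUnique gcd≡1 {x} x′≡x x³≡1 = residue (q-1 ℕ.% 3) (m≡m%n+[m/n]*n q-1 3) (m%n<n q-1 3)
    where
    q-1 = q ℕ.∸ 1
    x^q-1≡1 : x ^ q-1 ≡ 1#
    x^q-1≡1 = *-cancelˡ (cubeRoot≢0 x³≡1) (trans
      (trans (cong (x ^_) (ℕ.m+[n∸m]≡n (ℕ.<⇒≤ (2≤q primePower)))) x′≡x) (sym (*-identityʳ x)))
    x^[r+j*3] : ∀ r j → x ^ (r ℕ.+ j ℕ.* 3) ≡ x ^ r
    x^[r+j*3] r j = begin
      x ^ (r ℕ.+ j ℕ.* 3)       ≡⟨ cong (λ n → x ^ (r ℕ.+ n)) (ℕ.*-comm j 3) ⟩
      x ^ (r ℕ.+ 3 ℕ.* j)       ≡⟨ ^-homo-* x r (3 ℕ.* j) ⟩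
      x ^ r * x ^ (3 ℕ.* j)     ≡⟨ cong (x ^ r *_) (^-assoc x 3 j) ⟨
      x ^ r * (x ^ 3) ^ j       ≡⟨ cong (λ z → x ^ r * z ^ j) x³≡1 ⟩
      x ^ r * 1# ^ j            ≡⟨ cong (x ^ r *_) (1^n≡1 j) ⟩
      x ^ r * 1#                ≡⟨ *-identityʳ _ ⟩
      x ^ r                     ∎
      where open ≡-Reasoning
    residue : ∀ r → q-1 ≡ r ℕ.+ q-1 ℕ./ 3 ℕ.* 3 → r ℕ.< 3 → x ≡ 1#
    residue 0 q-1≡ _ = contradiction
      (∣⇒≤ (subst (3 ∣_) gcd≡1 (gcd-greatest (∣-refl {3}) (divides (q-1 ℕ./ 3) q-1≡)))) λ { (s≤s ()) }
    residue r@1 q-1≡ _ = trans (sym (*-identityʳ x))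
      (trans (sym (x^[r+j*3] r (q-1 ℕ./ 3))) (trans (cong (x ^_) (sym q-1≡)) x^q-1≡1))
    residue r@2 q-1≡ _ = trans (sym (trans (cong (x *_) x²≡1) (*-identityʳ x))) x³≡1
      where
      x²≡1 : x ^ 2 ≡ 1#
      x²≡1 = trans (sym (x^[r+j*3] r (q-1 ℕ./ 3))) (trans (cong (x ^_) (sym q-1≡)) x^q-1≡1)
    residue (suc (suc (suc _))) _ (s≤s (s≤s (s≤s ())))

  -- With q - 1 = 3j the exponent m = j(q² + q + 1) is (q³ - 1)/3, so every nonzero m-th power is a
  -- cube root of unity, and it lies in F_q because q leaves remainder 1 modulo 3. As m + 1 is below
  -- the size of the field, some x has x^(m+1) ≠ x.
  ∃admissible : gcd 3 (q ℕ.∸ 1) ≡ 3 → ∃ Admissible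
  ∃admissible gcd≡3 with subst (_∣ q ℕ.∸ 1) gcd≡3 (gcd[m,n]∣n 3 (q ℕ.∸ 1))
  ... | divides j q-1≡j*3 = x ^ m , λ′≡λ , λ³≡1 , x^m≢1
    where
    m = j ℕ.* (q ℕ.* q ℕ.+ q ℕ.+ 1)
    q≡1+j*3 : q ≡ suc (j ℕ.* 3)
    q≡1+j*3 = trans (sym (ℕ.m+[n∸m]≡n (ℕ.<⇒≤ (2≤q primePower)))) (cong suc q-1≡j*3)
    card≡1+m*3 : card ≡ suc (m ℕ.* 3)
    card≡1+m*3 = trans card≡q³ (subst (λ n → n ℕ.^ 3 ≡ suc (j ℕ.* (n ℕ.* n ℕ.+ n ℕ.+ 1) ℕ.* 3)) (sym q≡1+j*3) (identity j))
      where
      open Data.Nat.Solver.+-*-Solver renaming (solve to ℕ-solve; con to N; _:=_ to _⊜_; _:+_ to _⊕_; _:*_ to _⊛_; _:^_ to _⊛^_) using ()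
      identity : ∀ j → suc (j ℕ.* 3) ℕ.^ 3 ≡
        suc (j ℕ.* (suc (j ℕ.* 3) ℕ.* suc (j ℕ.* 3) ℕ.+ suc (j ℕ.* 3) ℕ.+ 1) ℕ.* 3)
      identity = ℕ-solve 1 (λ j → let n = N 1 ⊕ (j ⊛ N 3) in n ⊛^ 3 ⊜ N 1 ⊕ (j ⊛ (n ⊛ n ⊕ n ⊕ N 1) ⊛ N 3)) refl
    1≤m : 1 ℕ.≤ m
    1≤m = ℕ.≤-trans (0<j j q≡1+j*3) (ℕ.m≤m*n j (q ℕ.* q ℕ.+ q ℕ.+ 1) {{ℕ.>-nonZero (ℕ.m≤n+m 1 (q ℕ.* q ℕ.+ q))}})
      where
      0<j : ∀ j → q ≡ suc (j ℕ.* 3) → 0 ℕ.< j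
      0<j zero    q≡1 = contradiction (subst (2 ℕ.≤_) q≡1 (2≤q primePower)) λ { (s≤s ()) }
      0<j (suc j) _   = s≤s z≤n
    1+m<card : suc m ℕ.< card
    1+m<card = subst (suc m ℕ.<_) (sym card≡1+m*3) (s≤s (ℕ.m<m*n m 3 {{ℕ.>-nonZero 1≤m}} (s≤s (s≤s z≤n))))
    nonfixed = ∃x^n≢x (s≤s 1≤m) 1+m<card
    x = proj₁ nonfixed
    x≢0 : x ≢ 0#
    x≢0 x≡0 = proj₂ nonfixed (trans (cong (λ z → z * x ^ m) x≡0) (trans (zeroˡ _) (sym x≡0)))
    x^m≢1 : x ^ m ≢ 1#
    x^m≢1 x^m≡1 = proj₂ nonfixed (trans (cong (x *_) x^m≡1) (*-identityʳ x))
    λ³≡1 : (x ^ m) ^ 3 ≡ 1#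
    λ³≡1 = trans (^-assoc x m 3) (*-cancelˡ x≢0
      (trans (trans (cong (x ^_) (sym card≡1+m*3)) (x^card≡x x)) (sym (*-identityʳ x))))
    λ′≡λ : x ^ m ′ ≡ x ^ m
    λ′≡λ = begin
      (x ^ m) ^ q                      ≡⟨ cong ((x ^ m) ^_) (trans q≡1+j*3 (cong suc (ℕ.*-comm j 3))) ⟩
      x ^ m * (x ^ m) ^ (3 ℕ.* j)      ≡⟨ cong (x ^ m *_) (^-assoc (x ^ m) 3 j) ⟨
      x ^ m * ((x ^ m) ^ 3) ^ j        ≡⟨ cong (λ z → x ^ m * z ^ j) λ³≡1 ⟩
      x ^ m * 1# ^ j                   ≡⟨ cong (x ^ m *_) (1^n≡1 j) ⟩
      x ^ m * 1#                       ≡⟨ *-identityʳ _ ⟩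
      x ^ m                            ∎
      where open ≡-Reasoning

  -- All admissible values are roots of 1 + X + X², which splits as (X - λ₀)(X - λ₀²) once λ₀ is one
  -- of them.
  card-Admissible : ∃ Admissible → HasCard 2 Admissible
  card-Admissible (λ₀ , adm@(_ , λ₀³≡1 , λ₀≢1)) =
    (λ₀ ∷ λ₀ * λ₀ ∷ []) , refl , ((λ₀≢λ₀² ∷ []) ∷ [] ∷ []) , λ μ → sound , complete
    where
    λ₀≢λ₀² : λ₀ ≢ λ₀ * λ₀
    λ₀≢λ₀² eq = λ₀≢1 (*-cancelˡ (cubeRoot≢0 λ₀³≡1) (trans (sym eq) (sym (*-identityʳ λ₀))))
    sound : ∀ {μ} → μ ∈ (λ₀ ∷ λ₀ * λ₀ ∷ []) → Admissible μ
    sound (here refl)         = adm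
    sound (there (here refl)) = admissible-square adm
    split : ∀ {μ} → 1# + μ + μ * μ ≡ 0# → 1# + λ₀ + λ₀ * λ₀ ≡ 0# → (μ - λ₀) * (μ - λ₀ * λ₀) ≡ 0#
    split {μ} = linear₂ (solve 2 (λ m l →
      (m :- l) :* (m :- l :* l) := 𝟙 :* (𝟙 :+ m :+ m :* m) :+ (l :- m :- 𝟙) :* (𝟙 :+ l :+ l :* l)) refl μ λ₀)
    complete : ∀ {μ} → Admissible μ → μ ∈ (λ₀ ∷ λ₀ * λ₀ ∷ [])
    complete (_ , μ³≡1 , μ≢1) = [ (λ e → here (x-y≡0⇒x≡y e)) , (λ e → there (here (x-y≡0⇒x≡y e))) ]′
      (xy≡0⇒x≡0⊎y≡0 (split (cubeRoot⇒1+x+x²≡0 μ³≡1 μ≢1) (cubeRoot⇒1+x+x²≡0 λ₀³≡1 λ₀≢1)))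

  -- The algebra of a fixed orbit

  module _ {w N S k U : K} (N′≡N : N ′ ≡ N) (S′≡S : S ′ ≡ S) (k≢0 : k ≢ 0#) (U≢0 : U ≢ 0#)
           (h₁ : 1# - w ′ ≡ k * U) (h₂ : N - w ≡ k * U ′) (h₃ : S - w ′ ′ ≡ k * U ′ ′) where
    private
      -- Produces the conjugates of `h₁`, `h₂`, `h₃`: the constants 1, N, S stay in place while w, k
      -- and U move on cyclically.
      conj : ∀ {a b x y z} → a ′ ≡ b → x ′ ≡ z → a - x ≡ y → b - z ≡ y ′
      conj {a} {b} {x} {y} {z} refl refl eq = trans (sym (minus-′ a x)) (cong _′ eq)

      h₁′ : 1# - w ′ ′ ≡ k ′ * U ′
      h₁′ = trans (conj 1′ refl h₁) (*-′ k U)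
      h₁′′ : 1# - w ≡ k ′ ′ * U ′ ′
      h₁′′ = trans (conj 1′ (x′′′≡x w) h₁′) (*-′ _ _)
      h₂′ : N - w ′ ≡ k ′ * U ′ ′
      h₂′ = trans (conj N′≡N refl h₂) (*-′ _ _)
      h₂′′ : N - w ′ ′ ≡ k ′ ′ * U
      h₂′′ = trans (conj N′≡N refl h₂′) (trans (*-′ _ _) (cong (k ′ ′ *_) (x′′′≡x U)))
      h₃′ : S - w ≡ k ′ * U
      h₃′ = trans (conj S′≡S (x′′′≡x w) h₃) (trans (*-′ _ _) (cong (k ′ *_) (x′′′≡x U)))

      -- Both products consist of the factors k, k′, U′, U″, paired differently. The next relation
      -- is the conjugate of this one.
      quadratic : (S - w ′ ′) * (1# - w ′ ′) - (N - w) * (N - w ′) ≡ 0#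
      quadratic = trans (cong₂ _-_ (cong₂ _*_ h₃ h₁′) (cong₂ _*_ h₂ h₂′))
        (solve 4 (λ k k₁ U₁ U₂ → k :* U₂ :* (k₁ :* U₁) :- k :* U₁ :* (k₁ :* U₂) := 𝟘) refl k (k ′) (U ′) (U ′ ′))

      quadratic′ : (S - w) * (1# - w) - (N - w ′) * (N - w ′ ′) ≡ 0#
      quadratic′ = trans (cong₂ _-_ (cong₂ _*_ h₃′ h₁′′) (cong₂ _*_ h₂′ h₂′′))
        (solve 4 (λ k₁ k₂ U U₂ → k₁ :* U :* (k₂ :* U₂) :- k₁ :* U₂ :* (k₂ :* U) := 𝟘) refl (k ′) (k ′ ′) U (U ′ ′))

      -- Difference of the two quadratic relations; it separates the case w ∈ F_q from the case in
      -- which w has trace 1 + N + S.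
      w-w′′∣ : (w - w ′ ′) * (w + w ′ + w ′ ′ - (S + 1# + N)) ≡ 0#
      w-w′′∣ = linear₂ (solve 5 (λ w w₁ w₂ N S →
        (w :- w₂) :* (w :+ w₁ :+ w₂ :- (S :+ 𝟙 :+ N)) :=
        𝟙 :* ((S :- w) :* (𝟙 :- w) :- (N :- w₁) :* (N :- w₂)) :+ (:- 𝟙) :* ((S :- w₂) :* (𝟙 :- w₂) :- (N :- w) :* (N :- w₁)))
        refl w (w ′) (w ′ ′) N S) quadratic′ quadratic

    -- If w were not in F_q, its conjugates would have the symmetric functions of 1, N, S,
    -- so w would be one of 1, N, S, which h₁, h₂, h₃ forbid.
    w-inFq : w * w ′ * w ′ ′ ≡ N * S → w ′ ≡ w
    w-inFq norm = [ (λ e → trans (cong _′ (x-y≡0⇒x≡y e)) (x′′′≡x w)) , (λ e → contradiction (cubic e) cubic≢0) ]′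
      (xy≡0⇒x≡0⊎y≡0 w-w′′∣)
      where
      cubic : w + w ′ + w ′ ′ - (S + 1# + N) ≡ 0# → (1# - w) * (N - w) * (S - w) ≡ 0#
      cubic e = linear₃ (solve 5 (λ w w₁ w₂ N S →
        (𝟙 :- w) :* (N :- w) :* (S :- w) :=
        (w :* (N :+ w₂) :- w :* w) :* (w :+ w₁ :+ w₂ :- (S :+ 𝟙 :+ N))
        :+ (:- w) :* ((S :- w₂) :* (𝟙 :- w₂) :- (N :- w) :* (N :- w₁)) :+ (:- 𝟙) :* (w :* w₁ :* w₂ :- N :* S))
        refl w (w ′) (w ′ ′) N S) e quadratic (x≡y⇒x-y≡0 norm)
      cubic≢0 : (1# - w) * (N - w) * (S - w) ≢ 0#
      cubic≢0 = xy≢0 (xy≢0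
        (λ e → xy≢0 (x′≢0 (x′≢0 k≢0)) (x′≢0 (x′≢0 U≢0)) (trans (sym h₁′′) e))
        (λ e → xy≢0 k≢0 (x′≢0 U≢0) (trans (sym h₂) e)))
        (λ e → xy≢0 (x′≢0 k≢0) U≢0 (trans (sym h₃′) e))

    -- For w in F_q the relation `geometric` makes U′/U an element of F_q of norm 1, thus a cube
    -- root of unity. The nonvanishing sum excludes the nontrivial ones, for which 1 + U′/U + U″/U
    -- is 0.
    N≡1×S≡1 : w ′ ≡ w → k * U + k * U ′ + k * U ′ ′ ≢ 0# → N ≡ 1# × S ≡ 1#
    N≡1×S≡1 w′≡w trace≢0 = N≡1 , S≡1
      where
      w′′≡w : w ′ ′ ≡ w
      w′′≡w = trans (cong _′ w′≡w) w′≡w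
      kU′≡k′U′′ : k * U ′ ≡ k ′ * U ′ ′
      kU′≡k′U′′ = trans (sym h₂) (trans (cong (λ z → N - z) (sym w′≡w)) h₂′)
      k′U′≡kU : k ′ * U ′ ≡ k * U
      k′U′≡kU = trans (sym h₁′) (trans (cong (λ z → 1# - z ′) w′≡w) h₁)
      geometric : U ′ * U ′ ≡ U * U ′ ′
      geometric = *-cancelˡ (xy≢0 k≢0 (x′≢0 k≢0)) (begin
        k * k ′ * (U ′ * U ′)        ≡⟨ solve 3 (λ k k₁ U₁ → k :* k₁ :* (U₁ :* U₁) := k :* U₁ :* (k₁ :* U₁)) refl k (k ′) (U ′) ⟩
        (k * U ′) * (k ′ * U ′)      ≡⟨ cong₂ _*_ kU′≡k′U′′ k′U′≡kU ⟩
        (k ′ * U ′ ′) * (k * U)      ≡⟨ solve 4 (λ k k₁ U U₂ → k₁ :* U₂ :* (k :* U) := k :* k₁ :* (U :* U₂)) refl k (k ′) U (U ′ ′) ⟩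
        k * k ′ * (U * U ′ ′)        ∎)
        where open ≡-Reasoning
      geometric′′ : U * U ≡ U ′ ′ * U ′
      geometric′′ = begin
        U * U                        ≡⟨ cong₂ _*_ (x′′′≡x U) (x′′′≡x U) ⟨
        U ′ ′ ′ * U ′ ′ ′            ≡⟨ trans (cong _′ (*-′ (U ′) (U ′))) (*-′ (U ′ ′) (U ′ ′)) ⟨
        (U ′ * U ′) ′ ′              ≡⟨ cong (λ z → z ′ ′) geometric ⟩
        (U * U ′ ′) ′ ′              ≡⟨ trans (cong _′ (*-′ U (U ′ ′))) (*-′ (U ′) (U ′ ′ ′)) ⟩
        U ′ ′ * U ′ ′ ′ ′            ≡⟨ cong (λ z → U ′ ′ * z ′) (x′′′≡x U) ⟩
        U ′ ′ * U ′                  ∎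
        where open ≡-Reasoning
      U′≡U : U ′ ≡ U
      -- (U + U′ + U″)(U′ - U) expands to (U′U′ - UU″) - (UU - U″U′), and both brackets vanish.
      U′≡U = x-y≡0⇒x≡y (xy≡0⇒y≡0 trace≢0 (linear₂
        (solve 4 (λ k U U₁ U₂ → (k :* U :+ k :* U₁ :+ k :* U₂) :* (U₁ :- U) :=
          k :* (U₁ :* U₁ :- U :* U₂) :+ (:- k) :* (U :* U :- U₂ :* U₁)) refl k U (U ′) (U ′ ′))
        (x≡y⇒x-y≡0 geometric) (x≡y⇒x-y≡0 geometric′′)))
      cancel : ∀ {a b} → a - w ≡ b - w → a ≡ b
      cancel {a} {b} e = x-y≡0⇒x≡y (trans (solve 3 (λ a b w → a :- b := a :- w :- (b :- w)) refl a b w) (x≡y⇒x-y≡0 e))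
      kU≡1-w : k * U ≡ 1# - w
      kU≡1-w = trans (sym h₁) (cong (λ z → 1# - z) w′≡w)
      N≡1 : N ≡ 1#
      N≡1 = cancel (trans h₂ (trans (cong (k *_) U′≡U) kU≡1-w))
      S≡1 : S ≡ 1#
      S≡1 = cancel (trans (cong (λ z → S - z) (sym w′′≡w)) (trans h₃ (trans (cong (k *_) (trans (cong _′ U′≡U) U′≡U)) kU≡1-w)))

  norm-inFq : ∀ x → (x * x ′ * x ′ ′) ′ ≡ x * x ′ * x ′ ′
  norm-inFq x rewrite *-′ (x * x ′) (x ′ ′) | *-′ x (x ′) | x′′′≡x x =
    solve 3 (λ a b c → b :* c :* a := a :* b :* c) refl x (x ′) (x ′ ′)

  orbit-algebra : ∀ {ρ σ k U} → k ≢ 0# → U ≢ 0# →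
    1# - ρ ′ * σ ′ ′ ≡ k * U → ρ * (ρ ′ * ρ ′ ′ - σ ′) ≡ k * U ′ → σ * (σ ′ * σ ′ ′ - ρ ′ ′) ≡ k * U ′ ′ →
    (1# - ρ ′ * σ ′ ′) + ρ * (ρ ′ * ρ ′ ′ - σ ′) + σ * (σ ′ * σ ′ ′ - ρ ′ ′) ≢ 0# →
    ρ * ρ ′ * ρ ′ ′ ≡ 1# × Admissible (ρ * σ ′)
  orbit-algebra {ρ} {σ} {k} {U} k≢0 U≢0 a b c det≢0 = N≡1 , w′≡w , w³≡1 , w≢1
    where
    w N S : K
    w = ρ * σ ′
    N = ρ * ρ ′ * ρ ′ ′
    S = σ * σ ′ * σ ′ ′
    w′ : w ′ ≡ ρ ′ * σ ′ ′
    w′ = *-′ ρ (σ ′)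
    w′′ : w ′ ′ ≡ ρ ′ ′ * σ
    w′′ = trans (cong _′ w′) (trans (*-′ _ _) (cong (ρ ′ ′ *_) (x′′′≡x σ)))
    h₁ : 1# - w ′ ≡ k * U
    h₁ = trans (cong (λ z → 1# - z) w′) a
    h₂ : N - w ≡ k * U ′
    h₂ = trans (solve 4 (λ r r₁ r₂ s₁ → r :* r₁ :* r₂ :- r :* s₁ := r :* (r₁ :* r₂ :- s₁)) refl ρ (ρ ′) (ρ ′ ′) (σ ′)) b
    h₃ : S - w ′ ′ ≡ k * U ′ ′
    h₃ = trans (cong (λ z → S - z) w′′) (trans
      (solve 4 (λ s s₁ s₂ r₂ → s :* s₁ :* s₂ :- r₂ :* s := s :* (s₁ :* s₂ :- r₂)) refl σ (σ ′) (σ ′ ′) (ρ ′ ′)) c)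
    norm : w * w ′ * w ′ ′ ≡ N * S
    norm = trans (cong₂ (λ x y → w * x * y) w′ w′′)
      (solve 6 (λ r r₁ r₂ s s₁ s₂ → r :* s₁ :* (r₁ :* s₂) :* (r₂ :* s) := r :* r₁ :* r₂ :* (s :* s₁ :* s₂))
        refl ρ (ρ ′) (ρ ′ ′) σ (σ ′) (σ ′ ′))
    w′≡w : w ′ ≡ w
    w′≡w = w-inFq (norm-inFq ρ) (norm-inFq σ) k≢0 U≢0 h₁ h₂ h₃ norm
    N≡1×S≡1′ : N ≡ 1# × S ≡ 1#
    N≡1×S≡1′ = N≡1×S≡1 (norm-inFq ρ) (norm-inFq σ) k≢0 U≢0 h₁ h₂ h₃ w′≡w
      (λ e → det≢0 (trans (cong₂ _+_ (cong₂ _+_ a b) c) e))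
    N≡1 : N ≡ 1#
    N≡1 = proj₁ N≡1×S≡1′
    w³≡1 : w ^ 3 ≡ 1#
    w³≡1 = begin
      w * (w * (w * 1#))      ≡⟨ solve 1 (λ w → w :* (w :* (w :* 𝟙)) := w :* w :* w) refl w ⟩
      w * w * w               ≡⟨ cong₂ (λ x y → w * x * y) w′≡w (trans (cong _′ w′≡w) w′≡w) ⟨
      w * w ′ * w ′ ′         ≡⟨ norm ⟩
      N * S                   ≡⟨ cong₂ _*_ N≡1 (proj₂ N≡1×S≡1′) ⟩
      1# * 1#                 ≡⟨ *-identityˡ 1# ⟩
      1#                      ∎
      where open ≡-Reasoning
    w≢1 : w ≢ 1#
    w≢1 w≡1 = xy≢0 k≢0 U≢0 (trans (sym h₁) (x≡y⇒x-y≡0 (sym (trans w′≡w w≡1))))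

  -- Coordinates in the projective plane

  0⃗ : V3
  0⃗ = 0# , 0# , 0#

  cross : V3 → V3 → V3
  cross (x , y , z) (a , b , c) = y * c - z * b , z * a - x * c , x * b - y * a

  ,,-cong : ∀ {x y z a b c : K} → x ≡ a → y ≡ b → z ≡ c → (x , y , z) ≡ (a , b , c)
  ,,-cong refl refl refl = refl

  _≟0⃗ : ∀ v → Dec (v ≡ 0⃗)
  (x , y , z) ≟0⃗ with x ≟ 0# | y ≟ 0# | z ≟ 0#
  ... | yes refl | yes refl | yes refl = yes refl
  ... | no  x≢0  | _        | _        = no λ { refl → x≢0 refl }
  ... | yes _    | no  y≢0  | _        = no λ { refl → y≢0 refl }
  ... | yes _    | yes _    | no  z≢0  = no λ { refl → z≢0 refl }

  ·-zero : ∀ c → c · 0⃗ ≡ 0⃗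
  ·-zero c = ,,-cong (zeroʳ c) (zeroʳ c) (zeroʳ c)

  ·-assoc : ∀ c d v → c · (d · v) ≡ (c * d) · v
  ·-assoc c d (x , y , z) = sym (,,-cong (*-assoc c d x) (*-assoc c d y) (*-assoc c d z))

  ·-identity : ∀ v → 1# · v ≡ v
  ·-identity (x , y , z) = ,,-cong (*-identityˡ x) (*-identityˡ y) (*-identityˡ z)

  ·-inverse : ∀ {c} v → c ≢ 0# → (c ⁻¹) · (c · v) ≡ v
  ·-inverse {c} v c≢0 = trans (·-assoc (c ⁻¹) c v) (trans (cong (_· v) (*-inverseˡ c≢0)) (·-identity v))

  ·-nonzero : ∀ {c v} → c ≢ 0# → v ≢ 0⃗ → c · v ≢ 0⃗
  ·-nonzero {c} {v} c≢0 v≢0 cv≡0 = v≢0 (trans (sym (·-inverse v c≢0)) (trans (cong ((c ⁻¹) ·_) cv≡0) (·-zero _)))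

  Inc-sym : ∀ v w → Inc v w → Inc w v
  Inc-sym (x , y , z) (a , b , c) = trans (cong₂ _+_ (cong₂ _+_ (*-comm x a) (*-comm y b)) (*-comm z c))

  Inc-· : ∀ k v w → Inc v w → Inc (k · v) w
  Inc-· k (x , y , z) (a , b , c) = linear₁ (solve 7 (λ k x y z a b c →
    a :* (k :* x) :+ b :* (k :* y) :+ c :* (k :* z) := k :* (a :* x :+ b :* y :+ c :* z)) refl k x y z a b c)

  Inc-·⁻¹ : ∀ {k} v w → k ≢ 0# → Inc (k · v) w → Inc v w
  Inc-·⁻¹ {k} v w k≢0 inc = subst (λ u → Inc u w) (·-inverse v k≢0) (Inc-· (k ⁻¹) (k · v) w inc)

  Inc-φ : ∀ v w → Inc v w → Inc (φ v) (φ w)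
  Inc-φ (x , y , z) (a , b , c) inc = begin
    c ′ * z ′ + a ′ * x ′ + b ′ * y ′
      ≡⟨ solve 3 (λ x y z → z :+ x :+ y := x :+ y :+ z) refl _ _ _ ⟩
    a ′ * x ′ + b ′ * y ′ + c ′ * z ′
      ≡⟨ cong₂ _+_ (cong₂ _+_ (*-′ a x) (*-′ b y)) (*-′ c z) ⟨
    (a * x) ′ + (b * y) ′ + (c * z) ′
      ≡⟨ trans (+-′ _ _) (cong (_+ (c * z) ′) (+-′ _ _)) ⟨
    (a * x + b * y + c * z) ′
      ≡⟨ trans (cong _′ inc) 0′ ⟩
    0# ∎
    where open ≡-Reasoning

  φ³ : ∀ v → φ (φ² v) ≡ v
  φ³ (x , y , z) = ,,-cong (x′′′≡x x) (x′′′≡x y) (x′′′≡x z)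

  φ-· : ∀ k v → φ (k · v) ≡ (k ′) · φ v
  φ-· k (x , y , z) = ,,-cong (*-′ k z) (*-′ k x) (*-′ k y)

  Inc-cross₁ : ∀ u v → Inc u (cross u v)
  Inc-cross₁ (x , y , z) (a , b , c) = solve 6 (λ x y z a b c →
    (y :* c :- z :* b) :* x :+ (z :* a :- x :* c) :* y :+ (x :* b :- y :* a) :* z := 𝟘) refl x y z a b c

  Inc-cross₂ : ∀ u v → Inc v (cross u v)
  Inc-cross₂ (x , y , z) (a , b , c) = solve 6 (λ x y z a b c →
    (y :* c :- z :* b) :* a :+ (z :* a :- x :* c) :* b :+ (x :* b :- y :* a) :* c := 𝟘) refl x y z a b c

  cross-·ˡ : ∀ k u v → cross (k · u) v ≡ k · cross u v
  cross-·ˡ k (x , y , z) (a , b , c) = ,,-cong (eq y z b c) (eq z x c a) (eq x y a b)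
    where
    eq : ∀ x y a b → k * x * b - k * y * a ≡ k * (x * b - y * a)
    eq = solve 5 (λ k x y a b → k :* x :* b :- k :* y :* a := k :* (x :* b :- y :* a)) refl k

  cross-·ʳ : ∀ k u v → cross u (k · v) ≡ k · cross u v
  cross-·ʳ k (x , y , z) (a , b , c) = ,,-cong (eq y z b c) (eq z x c a) (eq x y a b)
    where
    eq : ∀ x y a b → x * (k * b) - y * (k * a) ≡ k * (x * b - y * a)
    eq = solve 5 (λ k x y a b → x :* (k :* b) :- y :* (k :* a) := k :* (x :* b :- y :* a)) refl k

  cross-self : ∀ v → cross v v ≡ 0⃗
  cross-self (x , y , z) = ,,-cong (eq y z) (eq z x) (eq x y)
    where
    eq : ∀ x y → x * y - y * x ≡ 0#
    eq = solve 2 (λ x y → x :* y :- y :* x := 𝟘) refl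

  lineAt : Point → Line
  lineAt (pt1 b c) = ln1 b c
  lineAt (pt2 c)   = ln2 c
  lineAt pt3       = ln3

  -- Gives a line the point with the same coordinates, so that lemmas quantified over a point R with
  -- vector `rep R` apply to lines as well.
  dual : Line → Point
  dual (ln1 b c) = pt1 b c
  dual (ln2 c)   = pt2 c
  dual ln3       = pt3

  dual-lineAt : ∀ P → dual (lineAt P) ≡ P
  dual-lineAt (pt1 _ _) = refl
  dual-lineAt (pt2 _)   = refl
  dual-lineAt pt3       = refl

  lineAt-dual : ∀ ℓ → lineAt (dual ℓ) ≡ ℓ
  lineAt-dual (ln1 _ _) = refl
  lineAt-dual (ln2 _)   = refl
  lineAt-dual ln3       = refl

  dual-injective : ∀ {ℓ m} → dual ℓ ≡ dual m → ℓ ≡ m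
  dual-injective {ℓ} {m} eq = trans (sym (lineAt-dual ℓ)) (trans (cong lineAt eq) (lineAt-dual m))

  rep-dual : ∀ ℓ → rep (dual ℓ) ≡ lrep ℓ
  rep-dual (ln1 _ _) = refl
  rep-dual (ln2 _)   = refl
  rep-dual ln3       = refl

  rep≢0⃗ : ∀ P → rep P ≢ 0⃗
  rep≢0⃗ (pt1 _ _) eq = 0≢1 (sym (cong proj₁ eq))
  rep≢0⃗ (pt2 _)   eq = 0≢1 (sym (cong (proj₁ ∘ proj₂) eq))
  rep≢0⃗ pt3       eq = 0≢1 (sym (cong (proj₂ ∘ proj₂) eq))

  normalize : ∀ v → v ≢ 0⃗ → ∃[ P ] Represents P v
  normalize (x , y , z) v≢0 with x ≟ 0# | y ≟ 0# | z ≟ 0#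
  ... | no x≢0   | _        | _        = pt1 (x ⁻¹ * y) (x ⁻¹ * z) , x , x≢0 ,
    sym (,,-cong (*-identityʳ x) (x*[x⁻¹*y]≡y y x≢0) (x*[x⁻¹*y]≡y z x≢0))
  ... | yes refl | no y≢0   | _        = pt2 (y ⁻¹ * z) , y , y≢0 ,
    sym (,,-cong (zeroʳ y) (*-identityʳ y) (x*[x⁻¹*y]≡y z y≢0))
  ... | yes refl | yes refl | no z≢0   = pt3 , z , z≢0 ,
    sym (,,-cong (zeroʳ z) (zeroʳ z) (*-identityʳ z))
  ... | yes refl | yes refl | yes refl = contradiction refl v≢0

  cross-flip : ∀ u v → cross u v ≡ 0⃗ → cross v u ≡ 0⃗
  cross-flip (x , y , z) (a , b , c) eq = ,,-cong
    (linear₁ (flip y z b c) (cong proj₁ eq))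
    (linear₁ (flip z x c a) (cong (proj₁ ∘ proj₂) eq))
    (linear₁ (flip x y a b) (cong (proj₂ ∘ proj₂) eq))
    where
    flip : ∀ x y a b → a * y - b * x ≡ - 1# * (x * b - y * a)
    flip = solve 4 (λ x y a b → a :* y :- b :* x := (:- 𝟙) :* (x :* b :- y :* a)) refl

  -- Proportional representatives of one shape agree because of the leading 1. For different shapes
  -- a coordinate of the cross product is 1, after exchanging P and Q in the last three clauses.
  rep-cross⇒≡ : ∀ P Q → cross (rep P) (rep Q) ≡ 0⃗ → P ≡ Q
  rep-cross⇒≡ (pt1 b c) (pt1 b₁ c₁) eq = cong₂ pt1
    (sym (x-y≡0⇒x≡y (trans (solve 2 (λ x y → y :- x := 𝟙 :* y :- x :* 𝟙) refl b b₁) (cong (proj₂ ∘ proj₂) eq))))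
    (x-y≡0⇒x≡y (trans (solve 2 (λ x y → x :- y := x :* 𝟙 :- 𝟙 :* y) refl c c₁) (cong (proj₁ ∘ proj₂) eq)))
  rep-cross⇒≡ (pt1 b c) (pt2 c₁) eq = contradiction
    (trans (sym (cong (proj₂ ∘ proj₂) eq)) (solve 1 (λ x → 𝟙 :* 𝟙 :- x :* 𝟘 := 𝟙) refl b)) 0≢1
  rep-cross⇒≡ (pt2 c) (pt2 c₁) eq =
    cong pt2 (sym (x-y≡0⇒x≡y (trans (solve 2 (λ x y → y :- x := 𝟙 :* y :- x :* 𝟙) refl c c₁) (cong proj₁ eq))))
  rep-cross⇒≡ (pt2 c) pt3 eq = contradiction
    (trans (sym (cong proj₁ eq)) (solve 1 (λ x → 𝟙 :* 𝟙 :- x :* 𝟘 := 𝟙) refl c)) 0≢1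
  rep-cross⇒≡ pt3 (pt1 b c) eq = contradiction
    (trans (sym (cong (proj₁ ∘ proj₂) eq)) (solve 1 (λ x → 𝟙 :* 𝟙 :- 𝟘 :* x := 𝟙) refl c)) 0≢1
  rep-cross⇒≡ pt3 pt3 eq = refl
  rep-cross⇒≡ P@(pt2 _) Q@(pt1 _ _) eq = sym (rep-cross⇒≡ Q P (cross-flip (rep P) (rep Q) eq))
  rep-cross⇒≡ P@(pt1 _ _) Q@pt3     eq = sym (rep-cross⇒≡ Q P (cross-flip (rep P) (rep Q) eq))
  rep-cross⇒≡ P@pt3 Q@(pt2 _)       eq = sym (rep-cross⇒≡ Q P (cross-flip (rep P) (rep Q) eq))

  Represents-· : ∀ P {v} k → k ≢ 0# → Represents P v → Represents P (k · v)
  Represents-· P k k≢0 (c , c≢0 , refl) = k * c , xy≢0 k≢0 c≢0 , ·-assoc k c _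

  Represents-·⁻¹ : ∀ P k v → k ≢ 0# → Represents P (k · v) → Represents P v
  Represents-·⁻¹ P k v k≢0 r = subst (Represents P) (·-inverse v k≢0) (Represents-· P (k ⁻¹) (x⁻¹≢0 k≢0) r)

  Represents⇒≢0⃗ : ∀ P {v} → Represents P v → v ≢ 0⃗
  Represents⇒≢0⃗ P (c , c≢0 , refl) = ·-nonzero c≢0 (rep≢0⃗ P)

  cross-of-representatives : ∀ P Q {u v} → Represents P u → Represents Q v →
    ∃[ k ] (K* k × cross u v ≡ k · cross (rep P) (rep Q))
  cross-of-representatives P Q (c , c≢0 , refl) (d , d≢0 , refl) = c * d , xy≢0 c≢0 d≢0 ,
    trans (cross-·ˡ c (rep P) (d · rep Q)) (trans (cong (c ·_) (cross-·ʳ d (rep P) (rep Q))) (·-assoc c d _))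

  cross≡0⇒≡ : ∀ P Q {u v} → Represents P u → Represents Q v → cross u v ≡ 0⃗ → P ≡ Q
  cross≡0⇒≡ P Q r s eq with k , k≢0 , u×v≡ ← cross-of-representatives P Q r s = rep-cross⇒≡ P Q
    (trans (sym (·-inverse _ k≢0)) (trans (cong ((k ⁻¹) ·_) (trans (sym u×v≡) eq)) (·-zero _)))

  Represents-unique : ∀ P Q {v} → Represents P v → Represents Q v → P ≡ Q
  Represents-unique P Q r s = cross≡0⇒≡ P Q r s (cross-self _)

  Inc⇒Inc-rep : ∀ P {v} w → Represents P v → Inc v w → Inc (rep P) w
  Inc⇒Inc-rep P w (c , c≢0 , refl) = Inc-·⁻¹ (rep P) w c≢0

  Inc-rep⇒Inc : ∀ P {v} w → Represents P v → Inc (rep P) w → Inc v w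
  Inc-rep⇒Inc P w (c , c≢0 , refl) = Inc-· c (rep P) w

  Represents-φ : ∀ P {v} → Represents P v → ∃[ c ] (K* c × φ v ≡ c · φ (rep P))
  Represents-φ P (c , c≢0 , refl) = c ′ , x′≢0 c≢0 , φ-· c (rep P)

  Represents-φ² : ∀ P {v} → Represents P v → ∃[ c ] (K* c × φ² v ≡ c · φ² (rep P))
  Represents-φ² P (c , c≢0 , refl) = c ′ ′ , x′≢0 (x′≢0 c≢0) , trans (cong φ (φ-· c (rep P))) (φ-· (c ′) _)

  Inc-scale : ∀ {v v₀} w → ∃[ c ] (K* c × v ≡ c · v₀) → Inc v₀ w → Inc v w
  Inc-scale w (c , c≢0 , refl) = Inc-· c _ w

  -- k is the coordinate of the cross product at the place where `rep R` has its leading 1; it is 0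
  -- when u and v are dependent.
  cross-proportional : ∀ R u v → Inc u (rep R) → Inc v (rep R) → ∃[ k ] cross u v ≡ k · rep R
  cross-proportional (pt1 m n) (x , y , z) (a , b , c) p r = y * c - z * b , ,,-cong (sym (*-identityʳ _))
    (x-y≡0⇒x≡y (linear₂ (solve 8 (λ m n x y z a b c →
      z :* a :- x :* c :- (y :* c :- z :* b) :* m :=
      z :* (𝟙 :* a :+ m :* b :+ n :* c) :+ (:- c) :* (𝟙 :* x :+ m :* y :+ n :* z)) refl m n x y z a b c) r p))
    (x-y≡0⇒x≡y (linear₂ (solve 8 (λ m n x y z a b c →
      x :* b :- y :* a :- (y :* c :- z :* b) :* n :=
      (:- y) :* (𝟙 :* a :+ m :* b :+ n :* c) :+ b :* (𝟙 :* x :+ m :* y :+ n :* z)) refl m n x y z a b c) r p))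
  cross-proportional (pt2 n) (x , y , z) (a , b , c) p r = z * a - x * c ,
    ,,-cong
      (x-y≡0⇒x≡y (linear₂ (solve 7 (λ n x y z a b c → y :* c :- z :* b :- (z :* a :- x :* c) :* 𝟘 :=
        (:- z) :* (𝟘 :* a :+ 𝟙 :* b :+ n :* c) :+ c :* (𝟘 :* x :+ 𝟙 :* y :+ n :* z)) refl n x y z a b c) r p))
      (sym (*-identityʳ _))
      (x-y≡0⇒x≡y (linear₂ (solve 7 (λ n x y z a b c → x :* b :- y :* a :- (z :* a :- x :* c) :* n :=
        x :* (𝟘 :* a :+ 𝟙 :* b :+ n :* c) :+ (:- a) :* (𝟘 :* x :+ 𝟙 :* y :+ n :* z)) refl n x y z a b c) r p))
  cross-proportional pt3 (x , y , z) (a , b , c) p r = x * b - y * a ,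
    ,,-cong
      (x-y≡0⇒x≡y (linear₂ (solve 6 (λ x y z a b c → y :* c :- z :* b :- (x :* b :- y :* a) :* 𝟘 :=
        y :* (𝟘 :* a :+ 𝟘 :* b :+ 𝟙 :* c) :+ (:- b) :* (𝟘 :* x :+ 𝟘 :* y :+ 𝟙 :* z)) refl x y z a b c) r p))
      (x-y≡0⇒x≡y (linear₂ (solve 6 (λ x y z a b c → z :* a :- x :* c :- (x :* b :- y :* a) :* 𝟘 :=
        (:- x) :* (𝟘 :* a :+ 𝟘 :* b :+ 𝟙 :* c) :+ a :* (𝟘 :* x :+ 𝟘 :* y :+ 𝟙 :* z)) refl x y z a b c) r p))
      (sym (*-identityʳ _))

  Represents-cross : ∀ R {u v} → cross u v ≢ 0⃗ → Inc u (rep R) → Inc v (rep R) → Represents R (cross u v)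
  Represents-cross R {u} {v} u×v≢0 p r with k , u×v≡ ← cross-proportional R u v p r =
    k , (λ { refl → u×v≢0 (trans u×v≡ (0·v≡0 (rep R))) }) , u×v≡
    where
    0·v≡0 : ∀ v → 0# · v ≡ 0⃗
    0·v≡0 (x , y , z) = ,,-cong (zeroˡ x) (zeroˡ y) (zeroˡ z)

  lineOfNormal : ∀ u v {w} → w ≢ 0⃗ → Inc u w → Inc v w → ∃[ ℓ ] (Inc u (lrep ℓ) × Inc v (lrep ℓ))
  lineOfNormal u v {w} w≢0 p r = lineAt (proj₁ R) , on u p , on v r
    where
    R = normalize w w≢0
    on : ∀ u → Inc u w → Inc u (lrep (lineAt (proj₁ R)))
    on u p = subst (Inc u) (trans (cong rep (sym (dual-lineAt (proj₁ R)))) (rep-dual (lineAt (proj₁ R))))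
      (Inc-sym (rep (proj₁ R)) u (Inc⇒Inc-rep (proj₁ R) u (proj₂ R) (Inc-sym u w p)))

  private
    swap₁ : ∀ x y z → Inc (x , y , z) (y , - x , 0#)
    swap₁ = solve 3 (λ x y z → y :* x :+ (:- x) :* y :+ 𝟘 :* z := 𝟘) refl
    swap₂ : ∀ x y z → Inc (x , y , z) (0# , z , - y)
    swap₂ = solve 3 (λ x y z → 𝟘 :* x :+ z :* y :+ (:- y) :* z := 𝟘) refl

  -- Total in u and v, so callers need no proof of independence. If the cross product is 0, a
  -- nonzero one among (y, -x, 0), (0, z, -y) and their analogues for the second vector is a common
  -- normal; if all four vanish, so do both vectors and any line serves.
  lineThrough : ∀ u v → ∃[ ℓ ] (Inc u (lrep ℓ) × Inc v (lrep ℓ))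
  lineThrough u v with cross u v ≟0⃗
  ... | no  u×v≢0 = lineOfNormal u v u×v≢0 (Inc-cross₁ u v) (Inc-cross₂ u v)
  ... | yes u×v≡0 = parallel u v u×v≡0
    where
    parallel : ∀ u v → cross u v ≡ 0⃗ → ∃[ ℓ ] (Inc u (lrep ℓ) × Inc v (lrep ℓ))
    parallel (x , y , z) (a , b , c) eq
      with (y , - x , 0#) ≟0⃗ | (0# , z , - y) ≟0⃗ | (b , - a , 0#) ≟0⃗ | (0# , c , - b) ≟0⃗
    ... | no n | _ | _ | _ = lineOfNormal (x , y , z) (a , b , c) n (swap₁ x y z)
      (linear₁ (solve 5 (λ x y a b c → y :* a :+ (:- x) :* b :+ 𝟘 :* c := (:- 𝟙) :* (x :* b :- y :* a)) refl x y a b c)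
        (cong (proj₂ ∘ proj₂) eq))
    ... | yes _ | no n | _ | _ = lineOfNormal (x , y , z) (a , b , c) n (swap₂ x y z)
      (linear₁ (solve 5 (λ y z a b c → 𝟘 :* a :+ z :* b :+ (:- y) :* c := (:- 𝟙) :* (y :* c :- z :* b)) refl y z a b c)
        (cong proj₁ eq))
    ... | yes _ | yes _ | no n | _ = lineOfNormal (x , y , z) (a , b , c) n
      (linear₁ (solve 5 (λ x y z a b → b :* x :+ (:- a) :* y :+ 𝟘 :* z := 𝟙 :* (x :* b :- y :* a)) refl x y z a b)
        (cong (proj₂ ∘ proj₂) eq)) (swap₁ a b c)
    ... | yes _ | yes _ | yes _ | no n = lineOfNormal (x , y , z) (a , b , c) n
      (linear₁ (solve 5 (λ x y z b c → 𝟘 :* x :+ c :* y :+ (:- b) :* z := 𝟙 :* (y :* c :- z :* b)) refl x y z b c)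
        (cong proj₁ eq)) (swap₂ a b c)
    ... | yes p₁ | yes p₂ | yes p₃ | yes p₄ = ln3 , vanish x y z (cong (proj₁ ∘ proj₂) p₂) , vanish a b c (cong (proj₁ ∘ proj₂) p₄)
      where
      vanish : ∀ x y z → z ≡ 0# → Inc (x , y , z) (0# , 0# , 1#)
      vanish x y z = linear₁ (solve 3 (λ x y z → 𝟘 :* x :+ 𝟘 :* y :+ 𝟙 :* z := 𝟙 :* z) refl x y z)

  -- The planes π_λ

  curve : K → K → V3
  curve κ x = x , x ′ , κ * x ′ ′

  curve≢0⃗ : ∀ κ {x} → x ≢ 0# → curve κ x ≢ 0⃗
  curve≢0⃗ κ x≢0 eq = x≢0 (cong proj₁ eq)

  curvePoint : K → K → Point
  curvePoint κ x = pt1 (x ⁻¹ * x ′) (x ⁻¹ * (κ * x ′ ′))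

  Represents-curvePoint : ∀ κ {x} → x ≢ 0# → Represents (curvePoint κ x) (curve κ x)
  Represents-curvePoint κ {x} x≢0 = x , x≢0 , sym (,,-cong (*-identityʳ x) (x*[x⁻¹*y]≡y _ x≢0) (x*[x⁻¹*y]≡y _ x≢0))

  D-self : ∀ x → D x x ≡ 0#
  D-self x = solve 2 (λ a b → a :* b :- b :* a := 𝟘) refl x (x ′)

  D′≡ : ∀ x y → D x y ′ ≡ x ′ * y ′ ′ - x ′ ′ * y ′
  D′≡ x y rewrite minus-′ (x * y ′) (x ′ * y) | *-′ x (y ′) | *-′ (x ′) y = refl

  D′′≡ : ∀ x y → D x y ′ ′ ≡ x ′ ′ * y - x * y ′ ′
  D′′≡ x y rewrite D′≡ x y | minus-′ (x ′ * y ′ ′) (x ′ ′ * y ′) | *-′ (x ′) (y ′ ′) | *-′ (x ′ ′) (y ′)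
                 | x′′′≡x x | x′′′≡x y = refl

  -- With d = `D x y` the coordinates are κd′, κd″ and d; κ³ = 1 rewrites the last as κ·κ²·d, and d
  -- = (d′)″. Crossing thus sends the family κ to κ², and a second crossing sends it back, because
  -- κ⁴ = κ.
  cross-curve : ∀ {κ} → κ ^ 3 ≡ 1# → ∀ x y → cross (curve κ x) (curve κ y) ≡ κ · curve (κ * κ) (D x y ′)
  cross-curve {κ} κ³≡1 x y = ,,-cong
    (trans (solve 5 (λ κ x₁ x₂ y₁ y₂ → x₁ :* (κ :* y₂) :- κ :* x₂ :* y₁ := κ :* (x₁ :* y₂ :- x₂ :* y₁))
       refl κ (x ′) (x ′ ′) (y ′) (y ′ ′)) (cong (κ *_) (sym (D′≡ x y))))
    (trans (solve 5 (λ κ x x₂ y y₂ → κ :* x₂ :* y :- x :* (κ :* y₂) := κ :* (x₂ :* y :- x :* y₂))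
       refl κ x (x ′ ′) y (y ′ ′)) (cong (κ *_) (sym (D′′≡ x y))))
    (begin
      D x y                              ≡⟨ trans (cong (_* D x y) κ³≡1) (*-identityˡ _) ⟨
      κ * (κ * (κ * 1#)) * D x y         ≡⟨ solve 2 (λ κ d → κ :* (κ :* (κ :* 𝟙)) :* d := κ :* (κ :* κ :* d)) refl κ (D x y) ⟩
      κ * (κ * κ * D x y)                ≡⟨ cong (λ z → κ * (κ * κ * z)) (x′′′≡x (D x y)) ⟨
      κ * (κ * κ * D x y ′ ′ ′)          ∎)
    where open ≡-Reasoning

  cross-curve≡0⇒D≡0 : ∀ κ x y → cross (curve κ x) (curve κ y) ≡ 0⃗ → D x y ≡ 0#
  cross-curve≡0⇒D≡0 κ x y eq = cong (proj₂ ∘ proj₂) eq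

  curvePoint≡⇒D≡0 : ∀ κ {x y} → x ≢ 0# → y ≢ 0# → curvePoint κ x ≡ curvePoint κ y → D x y ≡ 0#
  curvePoint≡⇒D≡0 κ {x} {y} x≢0 y≢0 eq
    with c , c≢0 , vx≡ ← Represents-curvePoint κ x≢0 | d , d≢0 , vy≡ ← Represents-curvePoint κ y≢0 =
    cross-curve≡0⇒D≡0 κ x y (trans (cong₂ cross vx≡ vy≡)
      (trans (cross-·ˡ c (rep (curvePoint κ x)) (d · rep (curvePoint κ y))) (trans (cong (c ·_)
        (trans (cross-·ʳ d (rep (curvePoint κ x)) (rep (curvePoint κ y))) (trans (cong (d ·_)
          (trans (cong (λ P → cross (rep (curvePoint κ x)) (rep P)) (sym eq)) (cross-self _))) (·-zero d)))) (·-zero c))))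

  D≡0⇒curvePoint≡ : ∀ {κ x y} → κ ^ 3 ≡ 1# → x ≢ 0# → y ≢ 0# → D x y ≡ 0# → curvePoint κ x ≡ curvePoint κ y
  D≡0⇒curvePoint≡ {κ} {x} {y} κ³≡1 x≢0 y≢0 D≡0 =
    cross≡0⇒≡ (curvePoint κ x) (curvePoint κ y) (Represents-curvePoint κ x≢0) (Represents-curvePoint κ y≢0)
      (trans (cross-curve κ³≡1 x y) (trans (cong (κ ·_) (,,-cong
        D≡0′ (trans (cong _′ D≡0′) 0′)
        (trans (cong (κ * κ *_) (trans (x′′′≡x _) D≡0)) (zeroʳ _)))) (·-zero κ)))
    where
    D≡0′ : D x y ′ ≡ 0#
    D≡0′ = trans (cong _′ D≡0) 0′

  OnCurve : K → Point → Set
  OnCurve κ P = ∃[ x ] (K* x × Represents P (curve κ x))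

  -- A join of two points if R is the dual of a line, a meet of two lines if P and Q are.
  OnCurve-cross : ∀ {κ} → κ ^ 3 ≡ 1# → ∀ P Q R → OnCurve κ P → OnCurve κ Q → P ≢ Q →
    Inc (rep P) (rep R) → Inc (rep Q) (rep R) → OnCurve (κ * κ) R
  OnCurve-cross {κ} κ³≡1 P Q R (x , x≢0 , Px) (y , y≢0 , Qy) P≢Q PR QR =
    D x y ′ , (λ U≡0 → x×y≢0 (trans (cross-curve κ³≡1 x y) (trans (cong (κ ·_) (v0 U≡0)) (·-zero κ)))) ,
    Represents-·⁻¹ R κ (curve (κ * κ) (D x y ′)) (cubeRoot≢0 κ³≡1)
      (subst (Represents R) (cross-curve κ³≡1 x y)
        (Represents-cross R x×y≢0 (Inc-rep⇒Inc P (rep R) Px PR) (Inc-rep⇒Inc Q (rep R) Qy QR)))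
    where
    x×y≢0 : cross (curve κ x) (curve κ y) ≢ 0⃗
    x×y≢0 = P≢Q ∘ cross≡0⇒≡ P Q Px Qy
    v0 : ∀ {u} → u ≡ 0# → curve (κ * κ) u ≡ 0⃗
    v0 refl = ,,-cong refl 0′ (trans (cong (κ * κ *_) (trans (cong _′ 0′) 0′)) (zeroʳ _))

  φ-curve : ∀ {κ} → InFq κ → ∀ x → φ (curve κ x) ≡ (κ * x , x ′ , x ′ ′)
  φ-curve {κ} κ′≡κ x = ,,-cong (trans (*-′ κ (x ′ ′)) (cong₂ _*_ κ′≡κ (x′′′≡x x))) refl refl

  φ²-curve : ∀ {κ} → InFq κ → ∀ x → φ² (curve κ x) ≡ (x , κ * x ′ , x ′ ′)
  φ²-curve {κ} κ′≡κ x = trans (cong φ (φ-curve κ′≡κ x)) (,,-cong (x′′′≡x x) (trans (*-′ κ x) (cong (_* x ′) κ′≡κ)) refl)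

  module _ {κ} (adm : Admissible κ) where
    private
      κ′≡κ : InFq κ
      κ′≡κ = proj₁ adm
      κ³≡1 : κ ^ 3 ≡ 1#
      κ³≡1 = proj₁ (proj₂ adm)
      1+κ+κ²≡0 : 1# + κ + κ * κ ≡ 0#
      1+κ+κ²≡0 = cubeRoot⇒1+x+x²≡0 κ³≡1 (proj₂ (proj₂ adm))
      1-κ≢0 : 1# - κ ≢ 0#
      1-κ≢0 e = proj₂ (proj₂ adm) (sym (x-y≡0⇒x≡y e))
      2+κ≢0 : 1# + 1# + κ ≢ 0#
      2+κ≢0 e = proj₂ (proj₂ (admissible-square adm)) (x-y≡0⇒x≡y (linear₂
        (solve 1 (λ κ → κ :* κ :- 𝟙 := 𝟙 :* (𝟙 :+ κ :+ κ :* κ) :+ (:- 𝟙) :* (𝟙 :+ 𝟙 :+ κ)) refl κ) 1+κ+κ²≡0 e))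

      -- The rows come from a curve point and its images under φ and φ². Elimination leaves the
      -- factor (1 - κ)(2 + κ); if 2 + κ were 0, then 1 + κ + κ² = 0 would give κ² = 1.
      circulant : ∀ {X Y Z} → X + Y + κ * Z ≡ 0# → κ * X + Y + Z ≡ 0# → X + κ * Y + Z ≡ 0# → X ≡ 0# × Y ≡ 0# × Z ≡ 0#
      circulant {X} {Y} {Z} r₁ r₂ r₃ =
        xy≡0⇒y≡0 [1-κ][2+κ]≢0 (linear₃ (solve 4 (λ κ X Y Z → (𝟙 :- κ) :* (𝟙 :+ 𝟙 :+ κ) :* X :=
          𝟙 :* (X :+ Y :+ κ :* Z) :+ (:- (𝟙 :+ κ)) :* (κ :* X :+ Y :+ Z) :+ 𝟙 :* (X :+ κ :* Y :+ Z)) refl κ X Y Z) r₁ r₂ r₃) ,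
        xy≡0⇒y≡0 [1-κ][2+κ]≢0 (linear₃ (solve 4 (λ κ X Y Z → (𝟙 :- κ) :* (𝟙 :+ 𝟙 :+ κ) :* Y :=
          𝟙 :* (X :+ Y :+ κ :* Z) :+ 𝟙 :* (κ :* X :+ Y :+ Z) :+ (:- (𝟙 :+ κ)) :* (X :+ κ :* Y :+ Z)) refl κ X Y Z) r₁ r₂ r₃) ,
        xy≡0⇒y≡0 [1-κ][2+κ]≢0 (linear₃ (solve 4 (λ κ X Y Z → (𝟙 :- κ) :* (𝟙 :+ 𝟙 :+ κ) :* Z :=
          (:- (𝟙 :+ κ)) :* (X :+ Y :+ κ :* Z) :+ 𝟙 :* (κ :* X :+ Y :+ Z) :+ 𝟙 :* (X :+ κ :* Y :+ Z)) refl κ X Y Z) r₁ r₂ r₃)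
        where
        [1-κ][2+κ]≢0 = xy≢0 1-κ≢0 2+κ≢0

    -- R stands for a line through the orbit of P when κ = λ₀, and for a point common to the orbit
    -- of a line when κ = λ₀² and P is the dual of that line.
    typeIII : ∀ P → OnCurve κ P → ∀ R → Inc (rep P) (rep R) → Inc (φ (rep P)) (rep R) → Inc (φ² (rep P)) (rep R) → ⊥
    typeIII P (x , x≢0 , Px) R i₁ i₂ i₃ = rep≢0⃗ R (go (rep R)
      (Inc-rep⇒Inc P (rep R) Px i₁)
      (subst (λ u → Inc u (rep R)) (φ-curve κ′≡κ x) (Inc-scale (rep R) (Represents-φ P Px) i₂))
      (subst (λ u → Inc u (rep R)) (φ²-curve κ′≡κ x) (Inc-scale (rep R) (Represents-φ² P Px) i₃)))
      where
      go : ∀ w → Inc (curve κ x) w → Inc (κ * x , x ′ , x ′ ′) w → Inc (x , κ * x ′ , x ′ ′) w → w ≡ 0⃗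
      go (a , b , c) i₁ i₂ i₃ = conclude (circulant
        (trans (solve 7 (λ κ x x₁ x₂ a b c → x :* a :+ x₁ :* b :+ κ :* (x₂ :* c)
          := a :* x :+ b :* x₁ :+ c :* (κ :* x₂)) refl κ x (x ′) (x ′ ′) a b c) i₁)
        (trans (solve 7 (λ κ x x₁ x₂ a b c → κ :* (x :* a) :+ x₁ :* b :+ x₂ :* c
          := a :* (κ :* x) :+ b :* x₁ :+ c :* x₂) refl κ x (x ′) (x ′ ′) a b c) i₂)
        (trans (solve 7 (λ κ x x₁ x₂ a b c → x :* a :+ κ :* (x₁ :* b) :+ x₂ :* c
          := a :* x :+ b :* (κ :* x₁) :+ c :* x₂) refl κ x (x ′) (x ′ ′) a b c) i₃))
        where
        conclude : x * a ≡ 0# × x ′ * b ≡ 0# × x ′ ′ * c ≡ 0# → (a , b , c) ≡ 0⃗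
        conclude (X≡0 , Y≡0 , Z≡0) = ,,-cong (xy≡0⇒y≡0 x≢0 X≡0) (xy≡0⇒y≡0 (x′≢0 x≢0) Y≡0) (xy≡0⇒y≡0 (x′≢0 (x′≢0 x≢0)) Z≡0)

    -- On parameters, μ is x ↦ x′x″. The factor 1 - κ reflects that for κ = 1 the collineation φ
    -- would fix every point of the curve.
    cross-φ-φ² : ∀ x → cross (φ (curve κ x)) (φ² (curve κ x)) ≡ (1# - κ) · curve (κ * κ) (x ′ * x ′ ′)
    cross-φ-φ² x = trans (cong₂ cross (φ-curve κ′≡κ x) (φ²-curve κ′≡κ x)) (,,-cong
      (solve 3 (λ κ x₁ x₂ → x₁ :* x₂ :- x₂ :* (κ :* x₁) := (𝟙 :- κ) :* (x₁ :* x₂)) refl κ (x ′) (x ′ ′))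
      (trans (solve 3 (λ κ x x₂ → x₂ :* x :- κ :* x :* x₂ := (𝟙 :- κ) :* (x₂ :* x)) refl κ x (x ′ ′))
        (cong ((1# - κ) *_) (sym u′)))
      (trans (x-y≡0⇒x≡y (linear₁
        (solve 3 (λ κ x x₁ → κ :* x :* (κ :* x₁) :- x₁ :* x :- (𝟙 :- κ) :* (κ :* κ :* (x :* x₁))
           := (κ :- 𝟙) :* (x :* x₁) :* (𝟙 :+ κ :+ κ :* κ)) refl κ x (x ′)) 1+κ+κ²≡0))
        (cong (λ z → (1# - κ) * (κ * κ * z)) (sym u′′))))
      where
      u′ : (x ′ * x ′ ′) ′ ≡ x ′ ′ * x
      u′ = trans (*-′ (x ′) (x ′ ′)) (cong (x ′ ′ *_) (x′′′≡x x))
      u′′ : (x ′ * x ′ ′) ′ ′ ≡ x * x ′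
      u′′ = trans (cong _′ u′) (trans (*-′ (x ′ ′) x) (cong (_* x ′) (x′′′≡x x)))

    μ-onCurve : ∀ P → OnCurve κ P → ∀ R → Inc (φ (rep P)) (rep R) → Inc (φ² (rep P)) (rep R) → OnCurve (κ * κ) R
    μ-onCurve P (x , x≢0 , Px) R i₂ i₃ = x ′ * x ′ ′ , u≢0 ,
      Represents-·⁻¹ R (1# - κ) _ 1-κ≢0 (subst (Represents R) (cross-φ-φ² x)
        (Represents-cross R (subst (_≢ 0⃗) (sym (cross-φ-φ² x)) (·-nonzero 1-κ≢0 (curve≢0⃗ (κ * κ) u≢0)))
          (Inc-scale (rep R) (Represents-φ P Px) i₂) (Inc-scale (rep R) (Represents-φ² P Px) i₃)))
      where
      u≢0 : x ′ * x ′ ′ ≢ 0#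
      u≢0 = xy≢0 (x′≢0 x≢0) (x′≢0 (x′≢0 x≢0))

    μ-exists : ∀ P → OnCurve κ P → ∃[ R ] (OnCurve (κ * κ) R × Inc (φ (rep P)) (rep R) × Inc (φ² (rep P)) (rep R))
    μ-exists P P∈@(x , x≢0 , Px) = dual ℓ , μ-onCurve P P∈ (dual ℓ) i₂ i₃ , i₂ , i₃
      where
      through = lineThrough (φ (rep P)) (φ² (rep P))
      ℓ = proj₁ through
      i₂ : Inc (φ (rep P)) (rep (dual ℓ))
      i₂ = subst (Inc (φ (rep P))) (sym (rep-dual ℓ)) (proj₁ (proj₂ through))
      i₃ : Inc (φ² (rep P)) (rep (dual ℓ))
      i₃ = subst (Inc (φ² (rep P))) (sym (rep-dual ℓ)) (proj₂ (proj₂ through))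

    OnCurve-κ⁴ : ∀ P → OnCurve (κ * κ * (κ * κ)) P → OnCurve κ P
    OnCurve-κ⁴ P = subst (λ κ → OnCurve κ P) (trans
      (solve 1 (λ κ → κ :* κ :* (κ :* κ) := κ :* (κ :* (κ :* (κ :* 𝟙)))) refl κ) (trans (cong (κ *_) κ³≡1) (*-identityʳ κ)))

  -- The kernel of the trace modulo F_q*

  D-+* : ∀ {t} x y z → InFq t → D z (x + t * y) ≡ D z x + t * D z y
  D-+* {t} x y z t′≡t = trans
    (cong (λ a → z * a - z ′ * (x + t * y)) (trans (+-′ x (t * y)) (cong (x ′ +_) (trans (*-′ t y) (cong (_* y ′) t′≡t)))))
    (solve 7 (λ t x x₁ y y₁ z z₁ → z :* (x₁ :+ t :* y₁) :- z₁ :* (x :+ t :* y)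
      := (z :* x₁ :- z₁ :* x) :+ t :* (z :* y₁ :- z₁ :* y)) refl t x (x ′) y (y ′) z (z ′))

  D-flip : ∀ x y → D x y ≡ - D y x
  D-flip x y = solve 4 (λ x x₁ y y₁ → x :* y₁ :- x₁ :* y := :- (y :* x₁ :- y₁ :* x)) refl x (x ′) y (y ′)

  Tr-+* : ∀ {t} x y → InFq t → Tr (x + t * y) ≡ Tr x + t * Tr y
  Tr-+* {t} x y t′≡t = trans (cong₂ (λ a b → x + t * y + a + b) eq eq′)
    (solve 7 (λ t x x₁ x₂ y y₁ y₂ → x :+ t :* y :+ (x₁ :+ t :* y₁) :+ (x₂ :+ t :* y₂)
      := x :+ x₁ :+ x₂ :+ t :* (y :+ y₁ :+ y₂)) refl t x (x ′) (x ′ ′) y (y ′) (y ′ ′))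
    where
    step : ∀ x y → (x + t * y) ′ ≡ x ′ + t * y ′
    step x y = trans (+-′ x (t * y)) (cong (x ′ +_) (trans (*-′ t y) (cong (_* y ′) t′≡t)))
    eq = step x y
    eq′ = trans (cong _′ eq) (step (x ′) (y ′))

  -- One representative of each class of (ker Tr ∖ 0) / F_q*.
  kernelReps : List K
  kernelReps = e₂ ∷ map (λ t → e₁ + t * e₂) Fq

  D-e₂ : ∀ {t} → InFq t → D e₂ (e₁ + t * e₂) ≡ - D e₁ e₂
  D-e₂ {t} t′≡t = trans (D-+* e₁ e₂ e₂ t′≡t) (trans
    (cong₂ (λ a b → a + t * b) (D-flip e₂ e₁) (D-self e₂))
    (solve 2 (λ d t → :- d :+ t :* 𝟘 := :- d) refl (D e₁ e₂) t))

  D-kernelReps : ∀ {s t} → InFq s → InFq t → D (e₁ + s * e₂) (e₁ + t * e₂) ≡ (t - s) * D e₁ e₂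
  D-kernelReps {s} {t} s′≡s t′≡t = trans (D-+* e₁ e₂ (e₁ + s * e₂) t′≡t) (trans (cong₂ (λ a b → a + t * b)
      (trans (D-flip (e₁ + s * e₂) e₁) (cong -_ (trans (D-+* e₁ e₂ e₁ s′≡s) (cong (_+ s * D e₁ e₂) (D-self e₁)))))
      (trans (D-flip (e₁ + s * e₂) e₂) (cong -_ (D-e₂ s′≡s))))
    (solve 3 (λ d s t → :- (𝟘 :+ s :* d) :+ t :* (:- (:- d)) := (t :- s) :* d) refl (D e₁ e₂) s t))

  -x≡0⇒x≡0 : ∀ {x} → - x ≡ 0# → x ≡ 0#
  -x≡0⇒x≡0 {x} = linear₁ (solve 1 (λ x → x := (:- 𝟙) :* (:- x)) refl x)

  private
    D-zeroˡ : ∀ y → D 0# y ≡ 0#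
    D-zeroˡ y = trans (cong (λ z → 0# * y ′ - z * y) 0′) (solve 2 (λ a b → 𝟘 :* a :- 𝟘 :* b := 𝟘) refl (y ′) y)

  e₂≢0 : e₂ ≢ 0#
  e₂≢0 e₂≡0 = D-e₁-e₂≢0 (-x≡0⇒x≡0 (trans (sym (D-flip e₂ e₁)) (trans (cong (λ z → D z e₁) e₂≡0) (D-zeroˡ e₁))))

  e₁+t*e₂≢0 : ∀ {t} → InFq t → e₁ + t * e₂ ≢ 0#
  e₁+t*e₂≢0 {t} t′≡t z≡0 = D-e₁-e₂≢0 (-x≡0⇒x≡0 (-x≡0⇒x≡0 (trans (cong -_ (sym (D-e₂ t′≡t)))
    (trans (sym (D-flip (e₁ + t * e₂) e₂)) (trans (cong (λ z → D z e₂) z≡0) (D-zeroˡ e₂))))))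

  kernelReps-nonzero : All (_≢ 0#) kernelReps
  kernelReps-nonzero = e₂≢0 ∷ All-map⁺ (All.tabulate (λ t∈ → e₁+t*e₂≢0 (∈Fq⇒inFq t∈)))

  kernelReps-Tr : All (λ z → Tr z ≡ 0#) kernelReps
  kernelReps-Tr = Tr-e₂ ∷ All-map⁺ (All.tabulate (λ {t} t∈ → trans (Tr-+* e₁ e₂ (∈Fq⇒inFq t∈))
    (trans (cong₂ (λ a b → a + t * b) Tr-e₁ Tr-e₂) (solve 1 (λ t → 𝟘 :+ t :* 𝟘 := 𝟘) refl t))))

  -- `D` is alternating and bilinear over F_q, so each pair of distinct representatives has as its
  -- value a nonzero multiple of `D e₁ e₂`: the factor is -1 for pairs with e₂ and t - s for e₁ +
  -- s·e₂ and e₁ + t·e₂.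
  kernelReps-independent : AllPairs (λ x y → D x y ≢ 0#) kernelReps
  kernelReps-independent =
    All-map⁺ (All.tabulate (λ t∈ D≡0 → D-e₁-e₂≢0 (-x≡0⇒x≡0 (trans (sym (D-e₂ (∈Fq⇒inFq t∈))) D≡0)))) ∷
    pairs Fq-unique ∈Fq⇒inFq
    where
    pairs : ∀ {ts} → Unique ts → (∀ {t} → t ∈ ts → InFq t) → AllPairs (λ x y → D x y ≢ 0#) (map (λ t → e₁ + t * e₂) ts)
    pairs [] _ = []
    pairs (t∉ts ∷ uts) inFq = All-map⁺ (All.tabulate λ t₁∈ D≡0 → All.lookup t∉ts t₁∈
        (sym (x-y≡0⇒x≡y (xy≡0⇒y≡0 D-e₁-e₂≢0 (trans (*-comm _ _)
          (trans (sym (D-kernelReps (inFq (here refl)) (inFq (there t₁∈)))) D≡0)))))) ∷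
      pairs uts (inFq ∘ there)

  -- If `D z e₂` is nonzero, then D z e₁ + t·D z e₂ = 0 can be solved for t, and t lies in F_q
  -- because both values of `D` do.
  kernelReps-complete : ∀ {z} → Tr z ≡ 0# → Any (λ y → D z y ≡ 0#) kernelReps
  kernelReps-complete {z} Trz≡0 with D z e₂ ≟ 0#
  ... | yes D≡0 = here D≡0
  ... | no  D≢0 = there (Any-map⁺ (lose (inFq⇒∈Fq t-inFq) (trans (D-+* e₁ e₂ z t-inFq)
        (trans (cong (D z e₁ +_) (t*D≡)) (-‿inverseʳ (D z e₁))))))
    where
    α = D z e₂
    t = - (α ⁻¹ * D z e₁)
    t*D≡ : t * α ≡ - D z e₁
    t*D≡ = trans (solve 3 (λ a i b → (:- (i :* b)) :* a := :- (a :* (i :* b))) refl α (α ⁻¹) (D z e₁))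
      (cong -_ (x*[x⁻¹*y]≡y (D z e₁) D≢0))
    t-inFq : InFq t
    t-inFq = *-cancelˡ D≢0 (begin
      α * t ′          ≡⟨ cong (_* t ′) (D-inFq Trz≡0 Tr-e₂) ⟨
      α ′ * t ′        ≡⟨ trans (cong _′ (*-comm t α)) (*-′ α t) ⟨
      (t * α) ′        ≡⟨ trans (cong _′ t*D≡) (neg-′ _) ⟩
      - (D z e₁ ′)     ≡⟨ cong -_ (D-inFq Trz≡0 Tr-e₁) ⟩
      - D z e₁         ≡⟨ t*D≡ ⟨
      t * α            ≡⟨ *-comm t α ⟩
      α * t            ∎)
      where open ≡-Reasoning

  -- The planes π_λ satisfy all the conditions

  module PlaneOf {λ₀} (adm : Admissible λ₀) (B : PointSet)
                 (B⇒ : ∀ P → B P → OnCurve λ₀ P) (⇒B : ∀ P → OnCurve λ₀ P → B P) where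
    private
      λ₀′≡λ₀ : InFq λ₀
      λ₀′≡λ₀ = proj₁ adm
      λ₀³≡1 : λ₀ ^ 3 ≡ 1#
      λ₀³≡1 = proj₁ (proj₂ adm)
      adm² : Admissible (λ₀ * λ₀)
      adm² = admissible-square adm

    -- Incidence of the line with parameter u and the point with parameter x: the factors λ₀² and λ₀
    -- of the third coordinates multiply to 1, and the trace form remains.
    Inc≡Tr : ∀ x u → u * x + u ′ * x ′ + λ₀ * λ₀ * u ′ ′ * (λ₀ * x ′ ′) ≡ Tr (u * x)
    Inc≡Tr x u = cong₂ _+_ (cong (u * x +_) (sym (*-′ u x))) (begin
      λ₀ * λ₀ * u ′ ′ * (λ₀ * x ′ ′)
        ≡⟨ solve 3 (λ l a b → l :* l :* a :* (l :* b) := l :* (l :* (l :* 𝟙)) :* (a :* b)) refl λ₀ (u ′ ′) (x ′ ′) ⟩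
      λ₀ ^ 3 * (u ′ ′ * x ′ ′)
        ≡⟨ trans (cong (_* (u ′ ′ * x ′ ′)) λ₀³≡1) (*-identityˡ _) ⟩
      u ′ ′ * x ′ ′
        ≡⟨ trans (cong _′ (*-′ u x)) (*-′ (u ′) (x ′)) ⟨
      (u * x) ′ ′ ∎)
      where open ≡-Reasoning

    -- Since q + 1 is at least 2, the list of points on ℓ begins with two distinct ones, and their
    -- join is known.
    LineOf⇒OnCurve : ∀ ℓ → LineOf B ℓ → OnCurve (λ₀ * λ₀) (dual ℓ)
    LineOf⇒OnCurve ℓ ([] , () , _)
    LineOf⇒OnCurve ℓ (P ∷ [] , 1≡1+q , _) =
      contradiction (subst (2 ℕ.≤_) (sym (ℕ.suc-injective 1≡1+q)) (2≤q primePower)) λ ()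
    LineOf⇒OnCurve ℓ (P ∷ Q ∷ Rs , _ , ((P≢Q ∷ _) ∷ _) , mem) =
      OnCurve-cross λ₀³≡1 P Q (dual ℓ) (B⇒ P (proj₁ memP)) (B⇒ Q (proj₁ memQ)) P≢Q
        (subst (Inc (rep P)) (sym (rep-dual ℓ)) (proj₂ memP))
        (subst (Inc (rep Q)) (sym (rep-dual ℓ)) (proj₂ memQ))
      where
      memP : B P × Inc (rep P) (lrep ℓ)
      memP = proj₁ (mem P) (here refl)
      memQ : B Q × Inc (rep Q) (lrep ℓ)
      memQ = proj₁ (mem Q) (there (here refl))

    -- The substitution y = ux turns the points of ℓ into classes of trace-zero elements, which
    -- `kernelReps` lists. Dividing by u multiplies `D` by a nonzero factor, so equality of points
    -- is still detected by `D`.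
    OnCurve⇒LineOf : ∀ ℓ → OnCurve (λ₀ * λ₀) (dual ℓ) → LineOf B ℓ
    OnCurve⇒LineOf ℓ (u , u≢0 , ℓu) = map point kernelReps ,
      trans (length-map point kernelReps) (cong suc (trans (length-map _ Fq) length-Fq)) ,
      unique kernelReps-nonzero kernelReps-independent ,
      λ P → (λ P∈ → sound P (∈-map⁻ point P∈)) , (λ { (BP , inc) → complete P (B⇒ P BP) inc })
      where
      point : K → Point
      point y = curvePoint λ₀ (u ⁻¹ * y)

      scaled≢0 : ∀ {y} → y ≢ 0# → u ⁻¹ * y ≢ 0#
      scaled≢0 = xy≢0 (x⁻¹≢0 u≢0)

      unique : ∀ {ys} → All (_≢ 0#) ys → AllPairs (λ x y → D x y ≢ 0#) ys → Unique (map point ys)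
      unique []           []             = []
      unique (y≢0 ∷ ys≢0) (D≢0 ∷ indep) = All-map⁺ (All.zipWith (λ { (z≢0 , D≢0) eq → D≢0
        (xy≡0⇒y≡0 (xy≢0 (x⁻¹≢0 u≢0) (x′≢0 (x⁻¹≢0 u≢0))) (trans (sym (D-scale (u ⁻¹) _ _))
          (curvePoint≡⇒D≡0 λ₀ (scaled≢0 y≢0) (scaled≢0 z≢0) eq))) }) (ys≢0 , D≢0)) ∷ unique ys≢0 indep

      sound : ∀ P → ∃[ y ] (y ∈ kernelReps × P ≡ point y) → B P × Inc (rep P) (lrep ℓ)
      sound P (y , y∈ , refl) = ⇒B P (u ⁻¹ * y , x≢0 , Px) ,
        subst (Inc (rep P)) (rep-dual ℓ) (Inc-sym (rep (dual ℓ)) (rep P) (Inc⇒Inc-rep (dual ℓ) (rep P) ℓu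
          (Inc-sym (rep P) (curve (λ₀ * λ₀) u) (Inc⇒Inc-rep P (curve (λ₀ * λ₀) u) Px
            (trans (Inc≡Tr (u ⁻¹ * y) u) (trans (cong Tr (x*[x⁻¹*y]≡y y u≢0)) (All.lookup kernelReps-Tr y∈)))))))
        where
        x≢0 : u ⁻¹ * y ≢ 0#
        x≢0 = scaled≢0 (All.lookup kernelReps-nonzero y∈)
        Px : Represents P (curve λ₀ (u ⁻¹ * y))
        Px = Represents-curvePoint λ₀ x≢0

      complete : ∀ P → OnCurve λ₀ P → Inc (rep P) (lrep ℓ) → P ∈ map point kernelReps
      complete P (x , x≢0 , Px) inc = member (find (kernelReps-complete Tr≡0))
        where
        Tr≡0 : Tr (u * x) ≡ 0#
        Tr≡0 = trans (sym (Inc≡Tr x u)) (Inc-sym (curve (λ₀ * λ₀) u) (curve λ₀ x) (Inc-rep⇒Inc (dual ℓ) (curve λ₀ x) ℓu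
          (Inc-sym (curve λ₀ x) (rep (dual ℓ)) (subst (Inc (curve λ₀ x)) (sym (rep-dual ℓ)) (Inc-rep⇒Inc P (lrep ℓ) Px inc)))))
        P≡ : ∀ {y} → y ∈ kernelReps → D (u * x) y ≡ 0# → P ≡ point y
        P≡ {y} y∈ D≡0 = trans (Represents-unique P (curvePoint λ₀ x) Px (Represents-curvePoint λ₀ x≢0))
          (D≡0⇒curvePoint≡ λ₀³≡1 x≢0 (scaled≢0 (All.lookup kernelReps-nonzero y∈)) (begin
            D x (u ⁻¹ * y)                   ≡⟨ cong (λ z → D z (u ⁻¹ * y)) (x⁻¹*[x*y]≡y x u≢0) ⟨
            D (u ⁻¹ * (u * x)) (u ⁻¹ * y)    ≡⟨ D-scale (u ⁻¹) (u * x) y ⟩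
            u ⁻¹ * u ⁻¹ ′ * D (u * x) y      ≡⟨ cong (u ⁻¹ * u ⁻¹ ′ *_) D≡0 ⟩
            u ⁻¹ * u ⁻¹ ′ * 0#               ≡⟨ zeroʳ _ ⟩
            0#                               ∎))
          where open ≡-Reasoning
        member : ∃[ y ] (y ∈ kernelReps × D (u * x) y ≡ 0#) → P ∈ map point kernelReps
        member (y , y∈ , D≡0) = subst (_∈ map point kernelReps) (sym (P≡ y∈ D≡0)) (∈-map⁺ point y∈)

    Inc-lrep⇒dual : ∀ w ℓ → Inc w (lrep ℓ) → Inc w (rep (dual ℓ))
    Inc-lrep⇒dual w ℓ = subst (Inc w) (sym (rep-dual ℓ))

    allTypeIII : AllTypeIII B
    allTypeIII = (λ P BP (ℓ , i₁ , i₂ , i₃) → typeIII adm P (B⇒ P BP) (dual ℓ)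
        (Inc-lrep⇒dual _ ℓ i₁) (Inc-lrep⇒dual _ ℓ i₂) (Inc-lrep⇒dual _ ℓ i₃)) ,
      λ ℓ ℓ∈ (P , i₁ , i₂ , i₃) → typeIII adm² (dual ℓ) (LineOf⇒OnCurve ℓ ℓ∈) P
        (subst (λ w → Inc w (rep P)) (sym (rep-dual ℓ)) (Inc-sym (rep P) _ i₁))
        (subst (λ w → Inc (φ w) (rep P)) (sym (rep-dual ℓ)) (Inc-sym (rep P) _ i₂))
        (subst (λ w → Inc (φ² w) (rep P)) (sym (rep-dual ℓ)) (Inc-sym (rep P) _ i₃))

    -- Apply φ once or twice and use that φ³ is the identity. This is why μ_pt and μ_line are
    -- inverse to each other.
    μ-flip : ∀ u w → Inc (φ u) w → Inc (φ² u) w → Inc u (φ w) × Inc u (φ² w)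
    μ-flip u w i₁ i₂ = subst (λ z → Inc z (φ w)) (φ³ u) (Inc-φ (φ² u) w i₂) ,
      subst (λ z → Inc z (φ² w)) (φ³ u) (Inc-φ (φ² u) (φ w) (Inc-φ (φ u) w i₁))

    μFixed-B : μFixed B
    μFixed-B =
      (λ P ℓ BP (i₁ , i₂) → OnCurve⇒LineOf ℓ
        (μ-onCurve adm P (B⇒ P BP) (dual ℓ) (Inc-lrep⇒dual _ ℓ i₁) (Inc-lrep⇒dual _ ℓ i₂))) ,
      (λ ℓ ℓ∈ → preimage ℓ (μ-exists adm² (dual ℓ) (LineOf⇒OnCurve ℓ ℓ∈))) ,
      (λ ℓ P ℓ∈ (i₁ , i₂) → ⇒B P (OnCurve-κ⁴ adm P (μ-onCurve adm² (dual ℓ) (LineOf⇒OnCurve ℓ ℓ∈) P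
        (subst (λ w → Inc (φ w) (rep P)) (sym (rep-dual ℓ)) (Inc-sym (rep P) _ i₁))
        (subst (λ w → Inc (φ² w) (rep P)) (sym (rep-dual ℓ)) (Inc-sym (rep P) _ i₂))))) ,
      (λ P BP → image P (μ-exists adm P (B⇒ P BP)))
      where
      preimage : ∀ ℓ → ∃[ R ] (OnCurve (λ₀ * λ₀ * (λ₀ * λ₀)) R
                   × Inc (φ (rep (dual ℓ))) (rep R) × Inc (φ² (rep (dual ℓ))) (rep R)) →
                 ∃[ P ] (B P × IsμPt P ℓ)
      preimage ℓ (R , R∈ , i₁ , i₂) with p , r ← μ-flip (rep (dual ℓ)) (rep R) i₁ i₂ = R , ⇒B R (OnCurve-κ⁴ adm R R∈) ,
        subst (Inc (φ (rep R))) (rep-dual ℓ) (Inc-sym (rep (dual ℓ)) _ p) ,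
        subst (Inc (φ² (rep R))) (rep-dual ℓ) (Inc-sym (rep (dual ℓ)) _ r)
      image : ∀ P → ∃[ R ] (OnCurve (λ₀ * λ₀) R × Inc (φ (rep P)) (rep R) × Inc (φ² (rep P)) (rep R)) →
              ∃[ ℓ ] (LineOf B ℓ × IsμLine ℓ P)
      image P (R , R∈ , i₁ , i₂) = lineAt R , OnCurve⇒LineOf (lineAt R) (subst (OnCurve (λ₀ * λ₀)) (sym (dual-lineAt R)) R∈) ,
        μ-flip (rep P) (lrep (lineAt R)) (subst (Inc _) rep≡lrep i₁) (subst (Inc _) rep≡lrep i₂)
        where
        rep≡lrep : rep R ≡ lrep (lineAt R)
        rep≡lrep = trans (cong rep (sym (dual-lineAt R))) (rep-dual (lineAt R))

    Inc-curve-+ : ∀ x y w → Inc (curve λ₀ x) w → Inc (curve λ₀ y) w → Inc (curve λ₀ (x + y)) w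
    Inc-curve-+ x y (a , b , c) i j = trans
      (cong₂ (λ s t → a * (x + y) + b * s + c * (λ₀ * t)) (+-′ x y) (trans (cong _′ (+-′ x y)) (+-′ (x ′) (y ′))))
      (linear₂ (solve 10 (λ l a b c x x₁ x₂ y y₁ y₂ → a :* (x :+ y) :+ b :* (x₁ :+ y₁) :+ c :* (l :* (x₂ :+ y₂)) :=
        𝟙 :* (a :* x :+ b :* x₁ :+ c :* (l :* x₂)) :+ 𝟙 :* (a :* y :+ b :* y₁ :+ c :* (l :* y₂)))
        refl λ₀ a b c x (x ′) (x ′ ′) y (y ′) (y ′ ′)) i j)

    Inc-curve-cancel : ∀ x y w → Inc (curve λ₀ (x + y)) w → Inc (curve λ₀ x) w → Inc (curve λ₀ y) w
    Inc-curve-cancel x y w i j = subst (λ z → Inc (curve λ₀ z) w) (solve 2 (λ x y → x :+ y :+ (:- 𝟙) :* x := y) refl x y)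
      (Inc-curve-+ (x + y) (- 1# * x) w i (neg w j))
      where
      neg : ∀ w → Inc (curve λ₀ x) w → Inc (curve λ₀ (- 1# * x)) w
      neg (a , b , c) j = trans
        (cong₂ (λ s t → a * (- 1# * x) + b * s + c * (λ₀ * t)) (neg′ x) (trans (cong _′ (neg′ x)) (neg′ (x ′))))
        (linear₁ (solve 7 (λ l a b c x x₁ x₂ → a :* ((:- 𝟙) :* x) :+ b :* ((:- 𝟙) :* x₁) :+ c :* (l :* ((:- 𝟙) :* x₂)) :=
          (:- 𝟙) :* (a :* x :+ b :* x₁ :+ c :* (l :* x₂))) refl λ₀ a b c x (x ′) (x ′ ′)) j)
        where
        neg′ : ∀ x → (- 1# * x) ′ ≡ - 1# * x ′
        neg′ x = trans (*-′ (- 1#) x) (cong (_* x ′) (trans (neg-′ 1#) (cong -_ 1′)))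

    -- For a line (a, b, c) the three incidences form a Vandermonde system in a, b and λ₀c at the
    -- conjugates of ζ.
    basis-independent : ∀ ℓ → Inc (curve λ₀ 1#) (lrep ℓ) → Inc (curve λ₀ ζ) (lrep ℓ) → Inc (curve λ₀ (ζ * ζ)) (lrep ℓ) → ⊥
    basis-independent ℓ i₀ i₁ i₂ = rep≢0⃗ (dual ℓ) (trans (rep-dual ℓ) (vanish (lrep ℓ) i₀ i₁ i₂))
      where
      vanish : ∀ w → Inc (curve λ₀ 1#) w → Inc (curve λ₀ ζ) w → Inc (curve λ₀ (ζ * ζ)) w → w ≡ 0⃗
      vanish (a , b , c) i₀ i₁ i₂ = conclude (vandermonde ζ≢ζ′ ζ′≢ζ′′ ζ′′≢ζ
        (trans (solve 4 (λ l a b c → a :+ b :+ l :* c := a :* 𝟙 :+ b :* 𝟙 :+ c :* (l :* 𝟙)) refl λ₀ a b c)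
          (trans (cong₂ (λ s t → a * 1# + b * s + c * (λ₀ * t)) (sym 1′) (sym (trans (cong _′ 1′) 1′))) i₀))
        (trans (solve 7 (λ l a b c z z₁ z₂ → z :* a :+ z₁ :* b :+ z₂ :* (l :* c) := a :* z :+ b :* z₁ :+ c :* (l :* z₂))
          refl λ₀ a b c ζ (ζ ′) (ζ ′ ′)) i₁)
        (trans (solve 7 (λ l a b c z z₁ z₂ → z :* z :* a :+ z₁ :* z₁ :* b :+ z₂ :* z₂ :* (l :* c)
            := a :* (z :* z) :+ b :* (z₁ :* z₁) :+ c :* (l :* (z₂ :* z₂))) refl λ₀ a b c ζ (ζ ′) (ζ ′ ′))
          (trans (cong₂ (λ s t → a * (ζ * ζ) + b * s + c * (λ₀ * t)) (sym (*-′ ζ ζ))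
            (sym (trans (cong _′ (*-′ ζ ζ)) (*-′ (ζ ′) (ζ ′))))) i₂)))
        where
        conclude : a ≡ 0# × b ≡ 0# × λ₀ * c ≡ 0# → (a , b , c) ≡ 0⃗
        conclude (a≡0 , b≡0 , λc≡0) = ,,-cong a≡0 b≡0 (xy≡0⇒y≡0 (cubeRoot≢0 λ₀³≡1) λc≡0)

    private
      -- Parameter of the fourth point of the quadrangle: as the sum of the basis 1, ζ, ζ² it plays
      -- the role of (1, 1, 1) in a frame.
      η : K
      η = 1# + ζ + ζ * ζ

      1≢0 : 1# ≢ 0#
      1≢0 = 0≢1 ∘ sym

      ζ≢0 : ζ ≢ 0#
      ζ≢0 ζ≡0 = ζ≢ζ′ (trans ζ≡0 (sym (trans (cong _′ ζ≡0) 0′)))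

      -- If η were 0, its curve vector would be 0 and lie on the line through the parameters 1 and
      -- ζ; by additivity ζ² would lie there too.
      η≢0 : η ≢ 0#
      η≢0 η≡0 = go (lineThrough (curve λ₀ 1#) (curve λ₀ ζ))
        where
        go : ∃[ ℓ ] (Inc (curve λ₀ 1#) (lrep ℓ) × Inc (curve λ₀ ζ) (lrep ℓ)) → ⊥
        go (ℓ , i₀ , i₁) = basis-independent ℓ i₀ i₁ (Inc-curve-cancel (1# + ζ) (ζ * ζ) (lrep ℓ)
          (vanishing (lrep ℓ)) (Inc-curve-+ 1# ζ (lrep ℓ) i₀ i₁))
          where
          vanishing : ∀ w → Inc (curve λ₀ η) w
          vanishing (a , b , c) = trans (cong₂ (λ s t → a * s + b * t + c * (λ₀ * t ′)) η≡0 (trans (cong _′ η≡0) 0′))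
            (trans (cong (λ t → a * 0# + b * 0# + c * (λ₀ * t)) 0′)
              (solve 4 (λ l a b c → a :* 𝟘 :+ b :* 𝟘 :+ c :* (l :* 𝟘) := 𝟘) refl λ₀ a b c))

    quadrangle : ∃[ P₁ ] ∃[ P₂ ] ∃[ P₃ ] ∃[ P₄ ] (B P₁ × B P₂ × B P₃ × B P₄
         × ¬ Collinear (rep P₁) (rep P₂) (rep P₃) × ¬ Collinear (rep P₁) (rep P₂) (rep P₄)
         × ¬ Collinear (rep P₁) (rep P₃) (rep P₄) × ¬ Collinear (rep P₂) (rep P₃) (rep P₄))
    quadrangle = curvePoint λ₀ 1# , curvePoint λ₀ ζ , curvePoint λ₀ (ζ * ζ) , curvePoint λ₀ η ,
      inB 1≢0 , inB ζ≢0 , inB (xy≢0 ζ≢0 ζ≢0) , inB η≢0 ,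
      (λ (ℓ , i , j , k) → basis-independent ℓ (inc ℓ 1≢0 i) (inc ℓ ζ≢0 j) (inc ℓ (xy≢0 ζ≢0 ζ≢0) k)) ,
      (λ (ℓ , i , j , k) → basis-independent ℓ (inc ℓ 1≢0 i) (inc ℓ ζ≢0 j)
        (Inc-curve-cancel (1# + ζ) (ζ * ζ) (lrep ℓ) (inc ℓ η≢0 k) (Inc-curve-+ 1# ζ (lrep ℓ) (inc ℓ 1≢0 i) (inc ℓ ζ≢0 j)))) ,
      (λ (ℓ , i , j , k) → basis-independent ℓ (inc ℓ 1≢0 i)
        (Inc-curve-cancel (1# + ζ * ζ) ζ (lrep ℓ) (subst (λ z → Inc (curve λ₀ z) (lrep ℓ))
            (solve 2 (λ o z → o :+ z :+ z :* z := o :+ z :* z :+ z) refl 1# ζ) (inc ℓ η≢0 k))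
          (Inc-curve-+ 1# (ζ * ζ) (lrep ℓ) (inc ℓ 1≢0 i) (inc ℓ (xy≢0 ζ≢0 ζ≢0) j)))
        (inc ℓ (xy≢0 ζ≢0 ζ≢0) j)) ,
      (λ (ℓ , i , j , k) → basis-independent ℓ
        (Inc-curve-cancel (ζ + ζ * ζ) 1# (lrep ℓ) (subst (λ z → Inc (curve λ₀ z) (lrep ℓ))
            (solve 2 (λ o z → o :+ z :+ z :* z := z :+ z :* z :+ o) refl 1# ζ) (inc ℓ η≢0 k))
          (Inc-curve-+ ζ (ζ * ζ) (lrep ℓ) (inc ℓ ζ≢0 i) (inc ℓ (xy≢0 ζ≢0 ζ≢0) j)))
        (inc ℓ ζ≢0 i) (inc ℓ (xy≢0 ζ≢0 ζ≢0) j))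
      where
      inB : ∀ {x} → x ≢ 0# → B (curvePoint λ₀ x)
      inB {x} x≢0 = ⇒B (curvePoint λ₀ x) (x , x≢0 , Represents-curvePoint λ₀ x≢0)
      inc : ∀ ℓ {x} → x ≢ 0# → Inc (rep (curvePoint λ₀ x)) (lrep ℓ) → Inc (curve λ₀ x) (lrep ℓ)
      inc ℓ {x} x≢0 = Inc-rep⇒Inc (curvePoint λ₀ x) (lrep ℓ) (Represents-curvePoint λ₀ x≢0)

    fqPlane : FqPlane B
    fqPlane =
      (λ P Q _ _ _ → lineThrough (rep P) (rep Q)) ,
      (λ P Q BP BQ P≢Q ℓ i j → OnCurve⇒LineOf ℓ (OnCurve-cross λ₀³≡1 P Q (dual ℓ) (B⇒ P BP) (B⇒ Q BQ) P≢Q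
        (Inc-lrep⇒dual _ ℓ i) (Inc-lrep⇒dual _ ℓ j))) ,
      (λ ℓ m ℓ∈ m∈ ℓ≢m → meet ℓ m ℓ∈ m∈ ℓ≢m (lineThrough (lrep ℓ) (lrep m))) ,
      quadrangle
      where
      meet : ∀ ℓ m → LineOf B ℓ → LineOf B m → ℓ ≢ m → ∃[ n ] (Inc (lrep ℓ) (lrep n) × Inc (lrep m) (lrep n)) →
             ∃[ P ] (B P × Inc (rep P) (lrep ℓ) × Inc (rep P) (lrep m))
      meet ℓ m ℓ∈ m∈ ℓ≢m (n , i , j) = dual n ,
        ⇒B (dual n) (OnCurve-κ⁴ adm (dual n) (OnCurve-cross (proj₁ (proj₂ adm²)) (dual ℓ) (dual m) (dual n)
          (LineOf⇒OnCurve ℓ ℓ∈) (LineOf⇒OnCurve m m∈) (ℓ≢m ∘ dual-injective)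
          (subst₂ Inc (sym (rep-dual ℓ)) (sym (rep-dual n)) i) (subst₂ Inc (sym (rep-dual m)) (sym (rep-dual n)) j))) ,
        Inc-sym (lrep ℓ) (rep (dual n)) (Inc-lrep⇒dual _ n i) ,
        Inc-sym (lrep m) (rep (dual n)) (Inc-lrep⇒dual _ n j)

    inOrbST : InOrbST B
    inOrbST = pt1 1# λ₀ , λ P →
      (λ BP → to P (B⇒ P BP)) , (λ (t , t≢0 , Pt) → ⇒B P (t , t≢0 , subst (Represents P) (ψ≡v t) Pt))
      where
      ψ≡v : ∀ t → ψ t (1# , 1# , λ₀) ≡ curve λ₀ t
      ψ≡v t = ,,-cong (*-identityʳ t) (*-identityʳ (t ′)) (trans (*-comm _ λ₀) (cong (λ₀ *_) (x^[q*q]≡x′′ t)))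
      to : ∀ P → OnCurve λ₀ P → ∃[ t ] (K* t × Represents P (ψ t (rep (pt1 1# λ₀))))
      to P (x , x≢0 , Px) = x , x≢0 , subst (Represents P) (sym (ψ≡v x)) Px

    good : Good B
    good = fqPlane , inOrbST , allTypeIII , μFixed-B

  -- Fixed orbits

  SameAs : PointSet → PointSet → Set
  SameAs B C = ∀ P → (B P → C P) × (C P → B P)

  ¬FqPlane-collinear : ∀ {B} ℓ → (∀ P → B P → Inc (rep P) (lrep ℓ)) → ¬ FqPlane B
  ¬FqPlane-collinear ℓ on (_ , _ , _ , P₁ , P₂ , P₃ , _ , B₁ , B₂ , B₃ , _ , notCollinear , _) =
    notCollinear (ℓ , on P₁ B₁ , on P₂ B₂ , on P₃ B₃)

  -- For independent v₁ and w the cross product is the normal of their join. Otherwise w = b·v₁,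
  -- where b is the middle coordinate of w, because that of v₁ is 1; so any line through u and v₁
  -- contains w.
  det≡0⇒collinear : ∀ u v₁ w → proj₁ (proj₂ v₁) ≡ 1# → Inc u (cross v₁ w) → Collinear u v₁ w
  det≡0⇒collinear u v₁@(x , _ , z) w@(a , b , c) refl u∈ with cross v₁ w ≟0⃗
  ... | no  v×w≢0 = on (lineThrough v₁ w)
    where
    on : ∃[ ℓ ] (Inc v₁ (lrep ℓ) × Inc w (lrep ℓ)) → Collinear u v₁ w
    on (ℓ , i , j) = ℓ , subst (Inc u) (rep-dual ℓ) (Inc-sym (rep (dual ℓ)) u
      (Inc⇒Inc-rep (dual ℓ) u (Represents-cross (dual ℓ) v×w≢0
        (subst (Inc v₁) (sym (rep-dual ℓ)) i) (subst (Inc w) (sym (rep-dual ℓ)) j)) (Inc-sym u (cross v₁ w) u∈))) , i , j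
  ... | yes v×w≡0 = on (lineThrough u v₁)
    where
    transfer : ∀ n → Inc v₁ n → Inc w n
    transfer (k , l , m) i = linear₃ (solve 8 (λ x z a b c k l m → k :* a :+ l :* b :+ m :* c :=
      b :* (k :* x :+ l :* 𝟙 :+ m :* z) :+ (:- k) :* (x :* b :- 𝟙 :* a) :+ m :* (𝟙 :* c :- z :* b)) refl x z a b c k l m)
      i (cong (proj₂ ∘ proj₂) v×w≡0) (cong proj₁ v×w≡0)
    on : ∃[ ℓ ] (Inc u (lrep ℓ) × Inc v₁ (lrep ℓ)) → Collinear u v₁ w
    on (ℓ , i , j) = ℓ , i , j , transfer (lrep ℓ) j

  module Orbit {ρ σ} (ρ≢0 : ρ ≢ 0#) (σ≢0 : σ ≢ 0#) (B : PointSet)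
               (orbit : ∀ P → (B P → ∃[ t ] (K* t × Represents P (ψ t (1# , ρ , σ))))
                            × (∃[ t ] (K* t × Represents P (ψ t (1# , ρ , σ))) → B P))
               (typeIII-B : AllTypeIII B) (μ-fixed : μFixed B) where
    P₀ : Point
    P₀ = pt1 ρ σ

    ψ≡ : ∀ t → ψ t (rep P₀) ≡ (t , ρ * t ′ , σ * t ′ ′)
    ψ≡ t = ,,-cong (*-identityʳ t) (*-comm _ _) (trans (*-comm _ _) (cong (σ *_) (x^[q*q]≡x′′ t)))

    P₀∈B : B P₀
    P₀∈B = proj₂ (orbit P₀) (1# , 0≢1 ∘ sym , 1# , 0≢1 ∘ sym , trans (ψ≡ 1#) (trans
      (,,-cong refl (trans (cong (ρ *_) 1′) (*-identityʳ ρ)) (trans (cong (σ *_) (trans (cong _′ 1′) 1′)) (*-identityʳ σ)))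
      (sym (·-identity (rep P₀)))))

    cross-orbit : ∀ x y → cross (ψ x (rep P₀)) (ψ y (rep P₀)) ≡ (ρ * σ * D x y ′ , σ * D x y ′ ′ , ρ * D x y)
    cross-orbit x y = trans (cong₂ cross (ψ≡ x) (ψ≡ y)) (,,-cong
      (trans (solve 6 (λ r s x₁ x₂ y₁ y₂ → r :* x₁ :* (s :* y₂) :- s :* x₂ :* (r :* y₁) := r :* s :* (x₁ :* y₂ :- x₂ :* y₁))
         refl ρ σ (x ′) (x ′ ′) (y ′) (y ′ ′)) (cong (ρ * σ *_) (sym (D′≡ x y))))
      (trans (solve 5 (λ s x x₂ y y₂ → s :* x₂ :* y :- x :* (s :* y₂) := s :* (x₂ :* y :- x :* y₂))
         refl σ x (x ′ ′) y (y ′ ′)) (cong (σ *_) (sym (D′′≡ x y))))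
      (solve 5 (λ r x x₁ y y₁ → x :* (r :* y₁) :- r :* x₁ :* y := r :* (x :* y₁ :- x₁ :* y)) refl ρ x (x ′) y (y ′)))

    α β γ : K
    α = 1# - ρ ′ * σ ′ ′
    β = ρ ′ * ρ ′ ′ - σ ′
    γ = σ ′ * σ ′ ′ - ρ ′ ′

    cross-φ-P₀ : cross (φ (rep P₀)) (φ² (rep P₀)) ≡ (α , β , γ)
    cross-φ-P₀ = trans (cong₂ (λ a b → cross (σ ′ , a , ρ ′) (ρ ′ ′ , σ ′ ′ , b)) 1′ (trans (cong _′ 1′) 1′)) (,,-cong
      (cong (_- ρ ′ * σ ′ ′) (*-identityˡ 1#))
      (cong (λ z → ρ ′ * ρ ′ ′ - z) (*-identityʳ (σ ′)))
      (cong (λ z → σ ′ * σ ′ ′ - z) (*-identityˡ (ρ ′ ′))))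

    det≢0 : α + ρ * β + σ * γ ≢ 0#
    det≢0 det≡0 = proj₁ typeIII-B P₀ P₀∈B (det≡0⇒collinear (rep P₀) (φ (rep P₀)) (φ² (rep P₀)) 1′
      (subst (Inc (rep P₀)) (sym cross-φ-P₀) (trans
        (solve 5 (λ r s a b c → a :* 𝟙 :+ b :* r :+ c :* s := a :+ r :* b :+ s :* c) refl ρ σ α β γ) det≡0)))

    cross-φ≢0 : cross (φ (rep P₀)) (φ² (rep P₀)) ≢ 0⃗
    cross-φ≢0 eq = det≢0 (vanish (trans (sym cross-φ-P₀) eq))
      where
      vanish : ∀ {a b c} → (a , b , c) ≡ 0⃗ → a + ρ * b + σ * c ≡ 0#
      vanish refl = solve 2 (λ r s → 𝟘 :+ r :* 𝟘 :+ s :* 𝟘 := 𝟘) refl ρ σ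

    -- The line μ_pt(P₀) has normal (α, β, γ); being a line of B it is also a join of two points of B.
    Factorization : Set
    Factorization = ∃[ k ] ∃[ U ] (k ≢ 0# × U ≢ 0# × α ≡ k * U × ρ * β ≡ k * U ′ × σ * γ ≡ k * U ′ ′)

    factorization : Factorization
    factorization = fromLine (lineThrough (φ (rep P₀)) (φ² (rep P₀)))
      where
      module _ (ℓ : Line) (i : Inc (φ (rep P₀)) (lrep ℓ)) (j : Inc (φ² (rep P₀)) (lrep ℓ)) where
        fromVectors : ∀ x y → Represents (dual ℓ) (α , β , γ) →
          Represents (dual ℓ) (ρ * σ * D x y ′ , σ * D x y ′ ′ , ρ * D x y) → Factorization
        fromVectors x y (c , c≢0 , eq) r@(d , d≢0 , eq₂) =
          k , U , xy≢0 (xy≢0 c≢0 (x⁻¹≢0 d≢0)) (xy≢0 ρ≢0 σ≢0) , U≢0 ,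
          trans (ratio (cong proj₁ eq) (cong proj₁ eq₂))
            (solve 4 (λ c′ r s u → c′ :* (r :* s :* u) := c′ :* (r :* s) :* u) refl (c * d ⁻¹) ρ σ U) ,
          trans (cong (ρ *_) (ratio (cong (proj₁ ∘ proj₂) eq) (cong (proj₁ ∘ proj₂) eq₂)))
            (solve 4 (λ c′ r s u → r :* (c′ :* (s :* u)) := c′ :* (r :* s) :* u) refl (c * d ⁻¹) ρ σ (U ′)) ,
          trans (cong (σ *_) (ratio (cong (proj₂ ∘ proj₂) eq) (cong (proj₂ ∘ proj₂) eq₂)))
            (trans (solve 4 (λ c′ r s u → s :* (c′ :* (r :* u)) := c′ :* (r :* s) :* u) refl (c * d ⁻¹) ρ σ (D x y))
              (cong (k *_) (sym (x′′′≡x (D x y)))))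
          where
          U k : K
          -- Then U′ and U″ are the other two conjugates of `D x y` in the join's normal. In k, the
          -- quotient c/d compares the two normals of ℓ, and ρσ is the factor common to all
          -- coordinates after weighting them by 1, ρ, σ.
          U = D x y ′
          k = c * d ⁻¹ * (ρ * σ)
          ratio : ∀ {a b e} → a ≡ c * e → b ≡ d * e → a ≡ c * d ⁻¹ * b
          ratio {e = e} refl refl = trans (cong (c *_) (sym (x⁻¹*[x*y]≡y e d≢0))) (sym (*-assoc _ _ _))
          U≢0 : U ≢ 0#
          U≢0 U≡0 = Represents⇒≢0⃗ (dual ℓ) r (vanish (x^n≡0⇒x≡0 q U≡0))
            where
            vanish : ∀ {z} → z ≡ 0# → (ρ * σ * z ′ , σ * z ′ ′ , ρ * z) ≡ 0⃗
            vanish refl = ,,-cong (trans (cong (ρ * σ *_) 0′) (zeroʳ _))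
              (trans (cong (σ *_) (trans (cong _′ 0′) 0′)) (zeroʳ _)) (zeroʳ _)

        fromPoints : ∀ P Q → P ≢ Q → B P × Inc (rep P) (lrep ℓ) → B Q × Inc (rep Q) (lrep ℓ) → Factorization
        fromPoints P Q P≢Q (BP , P∈ℓ) (BQ , Q∈ℓ) = join (proj₁ (orbit P) BP) (proj₁ (orbit Q) BQ)
          where
          onDual : ∀ {u} → Inc u (lrep ℓ) → Inc u (rep (dual ℓ))
          onDual {u} = subst (Inc u) (sym (rep-dual ℓ))
          join : ∃[ t ] (K* t × Represents P (ψ t (rep P₀))) → ∃[ t ] (K* t × Represents Q (ψ t (rep P₀))) → Factorization
          join (x , x≢0 , Px) (y , y≢0 , Qy) = fromVectors x y
            (subst (Represents (dual ℓ)) cross-φ-P₀ (Represents-cross (dual ℓ) cross-φ≢0 (onDual i) (onDual j)))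
            (subst (Represents (dual ℓ)) (cross-orbit x y) (Represents-cross (dual ℓ) (P≢Q ∘ cross≡0⇒≡ P Q Px Qy)
              (Inc-rep⇒Inc P (rep (dual ℓ)) Px (onDual P∈ℓ)) (Inc-rep⇒Inc Q (rep (dual ℓ)) Qy (onDual Q∈ℓ))))

        fromList : LineOf B ℓ → Factorization
        fromList ([] , () , _)
        fromList (P ∷ [] , 1≡1+q , _) =
          contradiction (subst (2 ℕ.≤_) (sym (ℕ.suc-injective 1≡1+q)) (2≤q primePower)) λ ()
        fromList (P ∷ Q ∷ _ , _ , ((P≢Q ∷ _) ∷ _) , mem) =
          fromPoints P Q P≢Q (proj₁ (mem P) (here refl)) (proj₁ (mem Q) (there (here refl)))

      fromLine : ∃[ ℓ ] (Inc (φ (rep P₀)) (lrep ℓ) × Inc (φ² (rep P₀)) (lrep ℓ)) → Factorization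
      fromLine (ℓ , i , j) = fromList ℓ i j (proj₁ μ-fixed P₀ ℓ P₀∈B (i , j))

    λ₀ : K
    λ₀ = ρ * σ ′

    norm-ρ×admissible : ρ * ρ ′ * ρ ′ ′ ≡ 1# × Admissible λ₀
    norm-ρ×admissible = conclude factorization
      where
      conclude : Factorization → ρ * ρ ′ * ρ ′ ′ ≡ 1# × Admissible λ₀
      conclude (k , U , k≢0 , U≢0 , a , b , c) = orbit-algebra k≢0 U≢0 a b c det≢0

    -- Conjugating ρc′ = c gives c = ρρ′c″, and λ₀ ∈ F_q gives λ₀ = σρ″. Multiplying these and using
    -- that ρ has norm 1 yields σc″ = cλ₀, so the substitution t = cx normalises both coordinates at
    -- once.
    ψ-rescale : ∀ {c} → ρ * c ′ ≡ c → ∀ x → ψ (c * x) (rep P₀) ≡ c · (x , x ^ q , λ₀ * x ^ (q ℕ.* q))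
    ψ-rescale {c} ρc′≡c x = trans (ψ≡ (c * x)) (,,-cong refl
      (trans (cong (ρ *_) (*-′ c x)) (trans (sym (*-assoc _ _ _)) (cong (_* x ′) ρc′≡c)))
      (begin
        σ * (c * x) ′ ′                ≡⟨ cong (σ *_) (trans (cong _′ (*-′ c x)) (*-′ (c ′) (x ′))) ⟩
        σ * (c ′ ′ * x ′ ′)            ≡⟨ *-assoc _ _ _ ⟨
        σ * c ′ ′ * x ′ ′              ≡⟨ cong (_* x ′ ′) σc′′≡cλ₀ ⟩
        c * λ₀ * x ′ ′                 ≡⟨ *-assoc _ _ _ ⟩
        c * (λ₀ * x ′ ′)               ≡⟨ cong (λ z → c * (λ₀ * z)) (x^[q*q]≡x′′ x) ⟨
        c * (λ₀ * x ^ (q ℕ.* q))       ∎))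
      where
      open ≡-Reasoning
      λ₀≡σρ′′ : λ₀ ≡ σ * ρ ′ ′
      λ₀≡σρ′′ = begin
        λ₀               ≡⟨ proj₁ (proj₂ norm-ρ×admissible) ⟨
        λ₀ ′             ≡⟨ cong _′ (proj₁ (proj₂ norm-ρ×admissible)) ⟨
        λ₀ ′ ′           ≡⟨ trans (cong _′ (*-′ ρ (σ ′))) (*-′ (ρ ′) (σ ′ ′)) ⟩
        ρ ′ ′ * σ ′ ′ ′  ≡⟨ trans (cong (ρ ′ ′ *_) (x′′′≡x σ)) (*-comm _ _) ⟩
        σ * ρ ′ ′        ∎
      σc′′≡cλ₀ : σ * c ′ ′ ≡ c * λ₀
      σc′′≡cλ₀ = sym (begin
        c * λ₀                           ≡⟨ cong₂ _*_ (sym c≡ρρ′c′′) λ₀≡σρ′′ ⟩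
        ρ * (ρ ′ * c ′ ′) * (σ * ρ ′ ′)
          ≡⟨ solve 5 (λ r r₁ r₂ s c → r :* (r₁ :* c) :* (s :* r₂) := r :* r₁ :* r₂ :* (s :* c)) refl ρ (ρ ′) (ρ ′ ′) σ (c ′ ′) ⟩
        ρ * ρ ′ * ρ ′ ′ * (σ * c ′ ′)    ≡⟨ trans (cong (_* (σ * c ′ ′)) (proj₁ norm-ρ×admissible)) (*-identityˡ _) ⟩
        σ * c ′ ′                        ∎)
        where
        c≡ρρ′c′′ : ρ * (ρ ′ * c ′ ′) ≡ c
        c≡ρρ′c′′ = trans (cong (ρ *_) (trans (sym (*-′ ρ (c ′))) (cong _′ ρc′≡c))) ρc′≡c

    B≡πλ : ∃[ λ′ ] (Admissible λ′ × SameAs B (πλ λ′))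
    B≡πλ = λ₀ , proj₂ norm-ρ×admissible , rescale (hilbert90 (proj₁ norm-ρ×admissible))
      where
      rescale : ∃[ c ] (c ≢ 0# × ρ * c ′ ≡ c) → SameAs B (πλ λ₀)
      rescale (c , c≢0 , ρc′≡c) P = (λ BP → to (proj₁ (orbit P) BP)) ,
        λ { (x , x≢0 , Px) → proj₂ (orbit P) (c * x , xy≢0 c≢0 x≢0 ,
          subst (Represents P) (sym (ψ-rescale ρc′≡c x)) (Represents-· P c c≢0 Px)) }
        where
        to : ∃[ t ] (K* t × Represents P (ψ t (rep P₀))) → πλ λ₀ P
        to (t , t≢0 , Pt) = c ⁻¹ * t , xy≢0 (x⁻¹≢0 c≢0) t≢0 , Represents-·⁻¹ P c _ c≢0
          (subst (Represents P) (trans (cong (λ z → ψ z (rep P₀)) (sym (x*[x⁻¹*y]≡y t c≢0))) (ψ-rescale ρc′≡c (c ⁻¹ * t))) Pt)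

  good⇒πλ : ∀ {B} → Good B → ∃[ λ′ ] (Admissible λ′ × SameAs B (πλ λ′))
  good⇒πλ {B} (plane , (P₀ , orbit) , typeIII-B , μ-fixed) = byRepresentative P₀ orbit
    where
    Orbit-of : Point → Set
    Orbit-of P₀ = ∀ P → (B P → ∃[ t ] (K* t × Represents P (ψ t (rep P₀))))
                      × (∃[ t ] (K* t × Represents P (ψ t (rep P₀))) → B P)

    -- Each `ψ t` preserves the coordinate lines, so a base point with a zero coordinate would put
    -- its whole orbit on one line, against the quadrangle. This is what makes ρ and σ nonzero.
    collinear : ∀ P₀ → Orbit-of P₀ → ∀ ℓ → (∀ t → Inc (ψ t (rep P₀)) (lrep ℓ)) → ⊥
    collinear P₀ orbit ℓ on = ¬FqPlane-collinear ℓ (λ P BP → onLine P (proj₁ (orbit P) BP)) plane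
      where
      onLine : ∀ P → ∃[ t ] (K* t × Represents P (ψ t (rep P₀))) → Inc (rep P) (lrep ℓ)
      onLine P (t , _ , Pt) = Inc⇒Inc-rep P (lrep ℓ) Pt (on t)

    byRepresentative : ∀ P₀ → Orbit-of P₀ → ∃[ λ′ ] (Admissible λ′ × SameAs B (πλ λ′))
    byRepresentative (pt2 c) orbit = ⊥-elim (collinear (pt2 c) orbit (ln1 0# 0#)
      (λ t → solve 3 (λ t y z → 𝟙 :* (t :* 𝟘) :+ 𝟘 :* y :+ 𝟘 :* z := 𝟘) refl t (t ^ q * 1#) (t ^ (q ℕ.* q) * c)))
    byRepresentative pt3 orbit = ⊥-elim (collinear pt3 orbit (ln1 0# 0#)
      (λ t → solve 3 (λ t y z → 𝟙 :* (t :* 𝟘) :+ 𝟘 :* y :+ 𝟘 :* z := 𝟘) refl t (t ^ q * 0#) (t ^ (q ℕ.* q) * 1#)))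
    byRepresentative (pt1 ρ σ) orbit with ρ ≟ 0# | σ ≟ 0#
    ... | no ρ≢0   | no σ≢0   = Orbit.B≡πλ ρ≢0 σ≢0 B orbit typeIII-B μ-fixed
    ... | yes refl | _        = ⊥-elim (collinear (pt1 0# σ) orbit (ln2 0#)
      (λ t → solve 3 (λ x y z → 𝟘 :* x :+ 𝟙 :* (y :* 𝟘) :+ 𝟘 :* z := 𝟘) refl (t * 1#) (t ^ q) (t ^ (q ℕ.* q) * σ)))
    ... | no _     | yes refl = ⊥-elim (collinear (pt1 ρ 0#) orbit ln3
      (λ t → solve 3 (λ x y z → 𝟘 :* x :+ 𝟘 :* y :+ 𝟙 :* (z :* 𝟘) := 𝟘) refl (t * 1#) (t ^ q * ρ) (t ^ (q ℕ.* q))))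

  πλ⇒good : ∀ {B} → ∃[ λ′ ] (Admissible λ′ × SameAs B (πλ λ′)) → Good B
  πλ⇒good {B} (λ₀ , adm , same) = PlaneOf.good adm B
    (λ P BP → to P (proj₁ (same P) BP))
    (λ P (x , x≢0 , Px) → proj₂ (same P) (x , x≢0 , subst (λ z → Represents P (x , x ′ , λ₀ * z)) (sym (x^[q*q]≡x′′ x)) Px))
    where
    to : ∀ P → πλ λ₀ P → OnCurve λ₀ P
    to P (x , x≢0 , Px) = x , x≢0 , subst (λ z → Represents P (x , x ′ , λ₀ * z)) (x^[q*q]≡x′′ x) Px

open import Data.Nat using (_^_; _∸_)

theorem4p2 : (q : ℕ) → IsPrimePower q → (F : FiniteField) → FiniteField.card F ≡ q ^ 3 →
    let open PG F q in
    (gcd 3 (q ∸ 1) ≡ 1 → ¬ (Σ PointSet Good))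
    × (gcd 3 (q ∸ 1) ≡ 3 →
    ((B : PointSet) → (Good B → ∃[ λ' ] (Admissible λ' × (∀ P → (B P → πλ λ' P) × (πλ λ' P → B P))))
    × (∃[ λ' ] (Admissible λ' × (∀ P → (B P → πλ λ' P) × (πλ λ' P → B P))) → Good B))
    × HasCard 2 Admissible)
theorem4p2 q primePower F card≡q³ =
  (λ gcd≡1 (B , B-good) → noPlane gcd≡1 (good⇒πλ B-good)) ,
  (λ gcd≡3 → (λ B → good⇒πλ , πλ⇒good) , card-Admissible (∃admissible gcd≡3))
  where
  open CubicField F q primePower card≡q³
  noPlane : gcd 3 (q ℕ.∸ 1) ≡ 1 → ∀ {B} → ∃[ λ′ ] (Admissible λ′ × SameAs B (πλ λ′)) → ⊥
  noPlane gcd≡1 (λ₀ , (λ₀′≡λ₀ , λ₀³≡1 , λ₀≢1) , _) = λ₀≢1 (cubeRootUnique gcd≡1 λ₀′≡λ₀ λ₀³≡1)
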